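{- Every retract of a Peano partial cube is a Peano partial cube.
   Context: For a connected graph $G$, $d_G$ is the shortest-path distance and $I_G(x,y)$ the set of vertices on shortest $(x,y)$-paths; $A\subseteq V(G)$ is convex if $I_G(x,y)\subseteq A$ for $x,y\in A$; $co_G(A)$ the smallest convex set containing $A$; a convex subgraph is one induced by a convex set. A partial cube is a graph isomorphic to an isometric subgraph of a (possibly infinite) hypercube. $\mathcal I_G(A)=\bigcup_{x,y\in A}I_G(x,y)$ with iterates $\mathcal I_G^n$; a copoint at $x$ is a convex set maximal with respect to not containing $x$; $ph(G)$ is the least $n$ with $co_G(C\cup\{x\})=\mathcal I_G^n(C\cup\{x\})$ for all vertices $x$ and copoints $C$ at $x$. A Peano partial cube is a partial cube all of whose finite convex subgraphs have pre-hull number at most $1$. A contraction $f:V(G)\to V(H)$ is a map with $d_H(f(x),f(y))\le d_G(x,y)$ for all $x,y$. An induced subgraph $H$ of $G$ is a retract of $G$ if there is a contraction $f:V(G)\to V(H)$ whose restriction to $V(H)$ is the identity. -}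

module Defs where

open import Level using (Level; _⊔_) renaming (suc to lsuc; zero to lzero)
open import Data.Nat using (ℕ; zero; suc; _+_; _≤_)
open import Data.Bool using (Bool)
open import Data.List using (List; length)
open import Data.List.Membership.Propositional using (_∈_)
open import Data.List.Relation.Unary.Unique.Propositional using (Unique)
open import Data.Product using (Σ; ∃; _×_; _,_; proj₁)
open import Data.Sum using (_⊎_)
open import Relation.Binary.PropositionalEquality using (_≡_; _≢_)
open import Relation.Nullary using (¬_)

record Graph : Set₁ where
  field
    V     : Set
    E     : V → V → Set
    sym   : ∀ {x y} → E x y → E y x
    irrfl : ∀ {x} → ¬ E x x

open Graph public

Subset : Set → Set₁
Subset X = X → Set

-- A subset is proposition-valued (so Σ X A is a genuine subset).
PropValued : {X : Set} → Subset X → Set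
PropValued {X} A = ∀ (x : X) (p q : A x) → p ≡ q

_⊆_ : {X : Set} → Subset X → Subset X → Set
A ⊆ B = ∀ x → A x → B x

module _ (G : Graph) where

  data Walk : V G → V G → ℕ → Set where
    here : ∀ {x} → Walk x x 0
    step : ∀ {x y z n} → E G x y → Walk y z n → Walk x z (suc n)

  Dist : V G → V G → ℕ → Set
  Dist x y n = Walk x y n × (∀ m → Walk x y m → n ≤ m)

  Connected : Set
  Connected = ∀ x y → ∃ λ n → Walk x y n

  Interval : V G → V G → V G → Set
  Interval x y z = ∃ λ a → ∃ λ b → Dist x z a × Dist z y b × Dist x y (a + b)

  IntervalHull : Subset (V G) → Subset (V G)
  IntervalHull A z = ∃ λ x → ∃ λ y → A x × A y × Interval x y z

  IntervalHullIter : ℕ → Subset (V G) → Subset (V G)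
  IntervalHullIter zero    A = A
  IntervalHullIter (suc n) A = IntervalHull (IntervalHullIter n A)

  Convex : Subset (V G) → Set
  Convex A = ∀ x y z → A x → A y → Interval x y z → A z

  co : Subset (V G) → V G → Set₁
  co A z = ∀ (B : Subset (V G)) → Convex B → A ⊆ B → B z

  Copoint : Subset (V G) → V G → Set₁
  Copoint C x = Convex C × ¬ C x
              × (∀ (D : Subset (V G)) → Convex D → C ⊆ D → ¬ D x → D ⊆ C)

  _∪｛_｝ : Subset (V G) → V G → Subset (V G)
  (C ∪｛ x ｝) z = C z ⊎ z ≡ x

  PreHullProperty : ℕ → Set₁
  PreHullProperty n = ∀ (x : V G) (C : Subset (V G)) → Copoint C x →
      (∀ z → co (C ∪｛ x ｝) z → IntervalHullIter n (C ∪｛ x ｝) z)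
    × (∀ z → IntervalHullIter n (C ∪｛ x ｝) z → co (C ∪｛ x ｝) z)

  -- ph(G) ≤ k  (ph(G) is the least n with the pre-hull property)
  PreHullAtMost : ℕ → Set₁
  PreHullAtMost k = ∃ λ n → n ≤ k × PreHullProperty n

Induced : (G : Graph) → Subset (V G) → Graph
Induced G S = record
  { V     = Σ (V G) S
  ; E     = λ u v → E G (proj₁ u) (proj₁ v)
  ; sym   = sym G
  ; irrfl = irrfl G
  }

HammingDist : {I : Set} → (I → Bool) → (I → Bool) → ℕ → Set
HammingDist {I} u v n =
  Σ (List I) λ ds → length ds ≡ n × Unique ds
                  × (∀ i → (u i ≢ v i → i ∈ ds) × (i ∈ ds → u i ≢ v i))

PartialCube : Graph → Set₁
PartialCube G = Connected G × Σ Set λ I → Σ (V G → (I → Bool)) λ φ →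
  ∀ x y n → (Dist G x y n → HammingDist (φ x) (φ y) n)
          × (HammingDist (φ x) (φ y) n → Dist G x y n)

Finite : {X : Set} → Subset X → Set
Finite {X} A = Σ (List X) λ xs → ∀ x → A x → x ∈ xs

PeanoPartialCube : Graph → Set₁
PeanoPartialCube G = PartialCube G ×
  (∀ (A : Subset (V G)) → PropValued A → Convex G A → Finite A →
     PreHullAtMost (Induced G A) 1)

Contraction : (G H : Graph) → (V G → V H) → Set
Contraction G H f = ∀ x y n → Dist G x y n →
  ∃ λ m → Dist H (f x) (f y) m × m ≤ n

IsRetract : (G : Graph) → Subset (V G) → Set
IsRetract G S = Σ (V G → Σ (V G) S) λ f →
  Contraction G (Induced G S) f × (∀ v (p : S v) → f v ≡ (v , p))

{-# OPTIONS --safe #-}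

-- Points of the partial cubes are read as bit vectors and betweenness is checked bit by bit.  Call P
-- "join-hull commutative" when every y in the hull of u, v, w lies on I(u,z) for some z in I(v,w).
-- Pre-hull number at most 1 on all faces gives this property: a minimal failure contains a pair of
-- directions e, t for which I(v,w) misses one of the four quadrants, and the pre-hull property of the
-- face e = u(e), used at the last maximal half-space entered on the way from u to a neighbour of y,
-- produces a smaller failure.
--
-- Conversely, write U for the ends, on a fixed side, of the edges in direction t.  Join-hull commutativity
-- shows that if q lies between a, b in U, and a, b are the only points of U on I(q,a), I(q,b), then every
-- p in U sees a or b through q.  Since a retraction f maps I(a,b) to itself whenever f fixes a and b, it
-- maps ends of t-edges on I(a,b) to ends of t-edges, so "nearest" has the same meaning in the retract, the
-- two-sided statement is inherited, and with it the pre-hull property of the retract.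
--
-- Everything combinatorial is proved up to double negation; the only witness finally needed is found by
-- searching the given finite convex set.

module Submission where

-- Join-hull commutativity does not pass to a retract by applying the retraction f to the point z:
-- once z is moved, d(u, f z) is bounded from above only, and y may drop off I(u, f z). What
-- survives concerns intervals whose two ends are fixed by f. This dictates the form of the
-- two-sided statement: a, b and q can be taken in the retract, p is an arbitrary end, and the
-- conclusion introduces no new point. Hence the detour from join-hull commutativity of P to the
-- pre-hull property of the faces of the retract, from which join-hull commutativity of the retract
-- follows by the theorem already used for P.

open import Defs hiding (sym) renaming (here to stay; step to along)
open import Data.Bool using (Bool; true; false; not; _∧_; _∨_; _xor_; T; if_then_else_)
open import Data.Bool.ListAction using (all)
import Data.Bool.Properties as Bool
open import Data.Empty using (⊥; ⊥-elim)
open import Data.Fin using (Fin; zero; suc)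
import Data.Fin as Fin
open import Data.Fin.Induction using (spo-noetherian)
open import Data.List using (List; []; _∷_; _++_; length; filter; [_]; allFin)
open import Data.List.Membership.Propositional using (_∈_; find; lose)
open import Data.List.Membership.Propositional.Properties using (∈-++⁺ˡ; ∈-++⁺ʳ; ∈-++⁻; ∈-∃++; ∈-filter⁺; ∈-filter⁻; ∈-allFin)
open import Data.List.Properties using (length-++)
open import Data.List.Relation.Binary.Permutation.Propositional.Properties using (↭-length; shift)
open import Data.List.Relation.Unary.All using ([]; _∷_)
import Data.List.Relation.Unary.All as All
open import Data.List.Relation.Unary.All.Properties using (all⁺; all⁻)
open import Data.List.Relation.Unary.AllPairs using ([]; _∷_)
open import Data.List.Relation.Unary.Any using (here; there; any?)
open import Data.List.Relation.Unary.Unique.Propositional using (Unique)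
import Data.List.Relation.Unary.Unique.Propositional.Properties as Unique
open import Data.Nat using (ℕ; zero; suc; _+_; _≤_; _<_; z≤n; s≤s; s<s; s≤s⁻¹)
import Data.Nat as Nat
open import Data.Nat.Induction using (<-wellFounded)
open import Data.Nat.Properties using (≤-refl; ≤-trans; ≤-antisym; ≤-reflexive; m≤n⇒m≤1+n; 1+n≰n; n≤1+n; +-mono-≤-<; +-monoʳ-≤; +-monoˡ-≤; +-cancelʳ-≤; +-cancelˡ-≤; module ≤-Reasoning)
open import Data.Product using (∃; _×_; _,_; proj₁; proj₂)
open import Data.Sum using (_⊎_; inj₁; inj₂; [_,_]′)
open import Data.Unit using (tt)
open import Data.Vec using (Vec; []; _∷_)
open import Function using (id)
open import Induction.WellFounded using (Acc; acc)
open import Relation.Binary.PropositionalEquality using (_≡_; _≢_; refl; sym; trans; cong; subst; subst₂; isEquivalence)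
open import Relation.Binary.Structures using (IsStrictPartialOrder)
open import Relation.Nullary using (¬_; Dec; yes; no; does)
open import Relation.Nullary.Decidable using (¬?; _×-dec_; decidable-stable)

-- Sequents of Boolean terms, decided by truth tables.

infix 0 _⊢_
record Sequent : Set where
  constructor _⊢_
  field
    hypotheses : List Bool
    conclusion : Bool

⟦_⟧ : Sequent → Set
⟦ [] ⊢ g ⟧ = T g
⟦ h ∷ hs ⊢ g ⟧ = T h → ⟦ hs ⊢ g ⟧

valid : Sequent → Bool
valid ([] ⊢ g) = g
valid (h ∷ hs ⊢ g) = not h ∨ valid (hs ⊢ g)

valid-sound : ∀ s → T (valid s) → ⟦ s ⟧
valid-sound ([] ⊢ g) v = v
valid-sound (true ∷ hs ⊢ g) v _ = valid-sound (hs ⊢ g) v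

Schema : ℕ → Set
Schema zero = Sequent
Schema (suc k) = Bool → Schema k

tautology : ∀ k → Schema k → Bool
tautology zero s = valid s
tautology (suc k) f = tautology k (f true) ∧ tautology k (f false)

Holds : ∀ k → Schema k → Set
Holds zero s = ⟦ s ⟧
Holds (suc k) f = ∀ b → Holds k (f b)

∧-left : ∀ a b → T (a ∧ b) → T a
∧-left true _ _ = tt

∧-right : ∀ a b → T (a ∧ b) → T b
∧-right true _ t = t

taut : ∀ k (f : Schema k) {_ : T (tautology k f)} → Holds k f
taut zero s {v} = valid-sound s v
taut (suc k) f {v} true = taut k (f true) {∧-left _ (tautology k (f false)) v}
taut (suc k) f {v} false = taut k (f false) {∧-right (tautology k (f true)) _ v}

infix 7 _⊕_ _==_
infixr 4 _⇒_
_⊕_ _==_ _⇒_ : Bool → Bool → Bool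
a ⊕ b = a xor b
a == b = not (a xor b)
a ⇒ b = not a ∨ b

decide : ∀ b → T b ⊎ T (not b)
decide true = inj₁ tt
decide false = inj₂ tt

reductio : ∀ b → ¬ T (not b) → T b
reductio b h = [ id , (λ m → ⊥-elim (h m)) ]′ (decide b)

excluded-middle : (Q : Set) → ¬ ¬ (Q ⊎ ¬ Q)
excluded-middle Q k = k (inj₂ λ q → k (inj₁ q))

==-refl : ∀ a → T (a == a)
==-refl = taut 1 λ a → [] ⊢ a == a

-- Bit vectors: betweenness, boxes and flips

Pt : ℕ → Set
Pt n = Fin n → Bool

bt : Bool → Bool → Bool → Bool
bt x z y = x == y ⇒ z == x

-- Convex sets of a partial cube are intersections of half-spaces, so this formula, required of
-- every bit, describes the convex hull of three points.
bx : Bool → Bool → Bool → Bool → Bool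
bx u v w y = u == v ∧ u == w ⇒ y == u

module _ {n : ℕ} where

  δ : Fin n → Fin n → Bool
  δ t c = does (t Fin.≟ c)

  δ-refl : ∀ t → T (δ t t)
  δ-refl t with t Fin.≟ t
  ... | yes _ = tt
  ... | no t≢t = t≢t refl

  δ-off : ∀ {s t} c → s ≢ t → T (δ s c ⇒ not (δ t c))
  δ-off {s} {t} c s≢t with s Fin.≟ c | t Fin.≟ c
  ... | yes refl | yes refl = s≢t refl
  ... | yes _ | no _ = tt
  ... | no _ | _ = tt

  δ-≢ : ∀ {s t} → s ≢ t → T (not (δ s t))
  δ-≢ {s} {t} s≢t with s Fin.≟ t
  ... | yes e = s≢t e
  ... | no _ = tt

  δ-≡ : ∀ {s t} → T (δ s t) → s ≡ t
  δ-≡ {s} {t} d with s Fin.≟ t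
  ... | yes e = e

  -- The device by which a fact known in the single direction `t` enters a truth table at an
  -- arbitrary `c`: it becomes a hypothesis guarded by `δ t c`.
  at : ∀ (f : Fin n → Bool) t → T (f t) → ∀ c → T (δ t c ⇒ f c)
  at f t h c with t Fin.≟ c
  ... | yes refl = h
  ... | no _ = tt

  flip : Fin n → Pt n → Pt n
  flip t x c = x c ⊕ δ t c

  btw : Pt n → Pt n → Pt n → Set
  btw x z y = ∀ c → T (bt (x c) (z c) (y c))

  Box : Pt n → Pt n → Pt n → Pt n → Set
  Box u v w y = ∀ c → T (bx (u c) (v c) (w c) (y c))

  infix 4 _≈_
  _≈_ : Pt n → Pt n → Set
  x ≈ y = ∀ c → T (x c == y c)

  counterexample : (f : Fin n → Bool) → ¬ (∀ c → T (f c)) → ¬ ¬ ∃ λ c → T (not (f c))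
  counterexample f h k = h λ c → reductio (f c) λ m → k (c , m)

  btw-refl : ∀ x y → btw x y y
  btw-refl x y c = taut 2 (λ x y → [] ⊢ bt x y y) (x c) (y c)

  btw-refl′ : ∀ x y → btw x x y
  btw-refl′ x y c = taut 2 (λ x y → [] ⊢ bt x x y) (x c) (y c)

tally : Bool → ℕ → ℕ
tally b k = if b then suc k else k

count : ∀ {n} → (Fin n → Bool) → ℕ
count {zero} f = 0
count {suc n} f = tally (f zero) (count (λ c → f (suc c)))

count-mono : ∀ {n} (f g : Fin n → Bool) → (∀ c → T (f c ⇒ g c)) → count f ≤ count g
count-mono {zero} f g h = z≤n
count-mono {suc n} f g h with f zero | g zero | h zero | count-mono (λ c → f (suc c)) (λ c → g (suc c)) (λ c → h (suc c))
... | true | true | _ | r = s≤s r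
... | false | true | _ | r = m≤n⇒m≤1+n r
... | false | false | _ | r = r

count-strict : ∀ {n} (f g : Fin n → Bool) → (∀ c → T (f c ⇒ g c)) →
  ∀ c → T (not (f c)) → T (g c) → count f < count g
count-strict f g h zero a b with f zero | g zero | h zero | count-mono (λ c → f (suc c)) (λ c → g (suc c)) (λ c → h (suc c))
... | false | true | _ | r = s≤s r
count-strict f g h (suc c) a b with f zero | g zero | h zero | count-strict (λ c → f (suc c)) (λ c → g (suc c)) (λ c → h (suc c)) c a b
... | true | true | _ | r = s<s r
... | false | true | _ | r = m≤n⇒m≤1+n r
... | false | false | _ | r = r

d : ∀ {n} → Pt n → Pt n → ℕ
d x y = count λ c → x c ⊕ y c

closer : ∀ {n} (x y : Pt n) t → T (x t ⊕ y t) → d (flip t x) y < d x y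
closer x y t h = count-strict (λ c → flip t x c ⊕ y c) (λ c → x c ⊕ y c)
  (λ c → taut 3 (λ x y δ → (δ ⇒ x ⊕ y) ∷ [] ⊢ (x ⊕ δ) ⊕ y ⇒ x ⊕ y)
    (x c) (y c) (δ t c) (at (λ c → x c ⊕ y c) t h c))
  t (taut 3 (λ x y δ → δ ∷ (x ⊕ y) ∷ [] ⊢ not ((x ⊕ δ) ⊕ y)) (x t) (y t) (δ t t) (δ-refl t) h) h

-- Lexicographic descent in which the earlier components need only not increase.

_≺_ : ∀ {k} → Vec ℕ k → Vec ℕ k → Set
[] ≺ [] = ⊥
(a ∷ as) ≺ (b ∷ bs) = a < b ⊎ a ≤ b × as ≺ bs

-- A descent in the tail may lower the head as well, so accessibility is proved for all heads up to
-- `n` at once, by induction on the tail.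
≺-cons : ∀ {k n} → (∀ {b} → b < n → (us : Vec ℕ k) → Acc _≺_ (b ∷ us)) →
  ∀ {vs} → Acc (_≺_ {k}) vs → ∀ {a} → a ≤ n → Acc _≺_ (a ∷ vs)
≺-cons wf (acc q) a≤n = acc λ
  { {b ∷ us} (inj₁ b<a) → wf (≤-trans b<a a≤n) us
  ; {b ∷ us} (inj₂ (b≤a , l)) → ≺-cons wf (q l) (≤-trans b≤a a≤n) }

≺-wellFounded : ∀ {k} (v : Vec ℕ k) → Acc _≺_ v
≺-wellFounded [] = acc λ { {[]} () }
≺-wellFounded (a ∷ as) = go (<-wellFounded a) as
  where
  go : ∀ {n} → Acc _<_ n → ∀ us → Acc _≺_ (n ∷ us)
  go (acc p) us = ≺-cons (λ b<n → go (p b<n)) (≺-wellFounded us) ≤-refl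

-- Isometric sets of bit vectors, the pre-hull property and join-hull commutativity

module _ {n : ℕ} (P : Pt n → Set) where

  -- Iterating such steps gives paths of Hamming length inside P; this is isometry without mention
  -- of paths.
  Isometric : Set
  Isometric = ∀ x y → P x → P y → ∀ c → T (x c ⊕ y c) →
    ¬ ¬ ∃ λ t → T (x t ⊕ y t) × P (flip t x)

  Ends : Fin n → Bool → Pt n → Set
  Ends t β s = P s × P (flip t s) × T (s t == β)

-- The intersection of the half-spaces containing `U`: no coordinate separates all of `U` from `q`.
-- At any coordinate it also refutes that `U` is empty.
Hull : ∀ {n} → (Pt n → Set) → Pt n → Set
Hull U q = ∀ c → ¬ (∀ s → U s → T (s c ⊕ q c))

module _ {n : ℕ} (P : Pt n → Set) where

  -- Pre-hull number at most 1 in terms of bits. If `p` lies in the hull of the ends, the opposite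
  -- side of `t` is a copoint at `p`; that `q` is reached from this copoint and `p` by one interval
  -- step means that some end lies beyond `q` as seen from `p`.
  PreHull : Set
  PreHull = ∀ t β p q → P p → P q → Hull (Ends P t β) p → Hull (Ends P t β) q →
    ¬ ¬ ∃ λ s → Ends P t β s × btw p q s

  JoinHull : Set
  JoinHull = ∀ u v w y → P u → P v → P w → P y → Box u v w y →
    ¬ ¬ ∃ λ z → P z × btw v z w × btw u y z

  Face : Pt n → Pt n → Pt n → Set
  Face m o x = P x × (∀ c → T (m c ⇒ x c == o c))

HereditaryPreHull : ∀ {n} → (Pt n → Set) → Set
HereditaryPreHull P = ∀ m o → PreHull (Face P m o)

module _ {n : ℕ} {P : Pt n → Set} (iso : Isometric P) where

  Face-isometric : ∀ m o → Isometric (Face P m o)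
  Face-isometric m o x y (Px , Fx) (Py , Fy) c x≠y k =
    iso x y Px Py c x≠y λ (t , xt , Pt) → k (t , xt , Pt , λ c →
      taut 5 (λ m o x y δ → (m ⇒ x == o) ∷ (m ⇒ y == o) ∷ (δ ⇒ x ⊕ y) ∷ [] ⊢ m ⇒ (x ⊕ δ) == o)
        (m c) (o c) (x c) (y c) (δ t c) (Fx c) (Fy c) (at (λ c → x c ⊕ y c) t xt c))

  -- Walk towards `y` until the step that changes the bit `t`; it starts at `s`.
  crossing : ∀ t x y → P x → P y → T (x t ⊕ y t) →
    ¬ ¬ ∃ λ s → P s × P (flip t s) × T (s t == x t) × btw x s y
  crossing t x y Px Py h = go x Px h (<-wellFounded (d x y))
    where
    go : ∀ x → P x → T (x t ⊕ y t) → Acc _<_ (d x y) →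
      ¬ ¬ ∃ λ s → P s × P (flip t s) × T (s t == x t) × btw x s y
    go x Px h (acc rs) k = iso x y Px Py t h λ (r , xr , Pr) → step r xr Pr
      where
      step : ∀ r → T (x r ⊕ y r) → P (flip r x) → ⊥
      step r xr Pr with decide (δ r t)
      ... | inj₁ δrt with δ-≡ {s = r} {t} δrt
      ...   | refl = k (x , Px , Pr , ==-refl (x t) , btw-refl′ x y)
      step r xr Pr | inj₂ ¬δ =
        go (flip r x) Pr
          (taut 3 (λ x y δ → not δ ∷ (x ⊕ y) ∷ [] ⊢ (x ⊕ δ) ⊕ y) (x t) (y t) (δ r t) ¬δ h)
          (rs (closer x y r xr))
          λ (s , Ps , Ps′ , e , b) → k (s , Ps , Ps′ ,
            taut 3 (λ x s δ → not δ ∷ (s == (x ⊕ δ)) ∷ [] ⊢ s == x) (x t) (s t) (δ r t) ¬δ e ,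
            λ c → taut 4 (λ x s y δ → (δ ⇒ x ⊕ y) ∷ bt (x ⊕ δ) s y ∷ [] ⊢ bt x s y)
              (x c) (s c) (y c) (δ r c) (at (λ c → x c ⊕ y c) r xr c) (b c))

-- From the pre-hull property of all faces to join-hull commutativity

module _ {n : ℕ} (A : Pt n → Set) (k : Pt n) where

  -- Inclusion, within A, of the half-spaces around k cut off by the directions h and g.
  Below : Fin n → Fin n → Set
  Below h g = ∀ a → A a → T (a h == k h) → T (a g == k g)

  -- Different directions may cut off the same half-space, so `Below` is only a preorder. The search
  -- climbs along its strict part, and maximality is meant up to mutual inclusion.
  maximal : (Q : Fin n → Set) → ∀ h → Q h →
    ¬ ¬ ∃ λ m → Q m × Below h m × (∀ g → Q g → Below m g → Below g m)
  maximal Q h Qh = go h Qh (spo-noetherian {_≈_ = _≡_} spo h)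
    where
    _⊏_ : Fin n → Fin n → Set
    h ⊏ g = Below h g × ¬ Below g h
    spo : IsStrictPartialOrder _≡_ _⊏_
    spo = record
      { isEquivalence = isEquivalence
      ; irrefl = λ { refl (p , q) → q p }
      ; trans = λ (p , q) (p′ , q′) → (λ a Aa e → p′ a Aa (p a Aa e)) , λ r → q λ a Aa e → r a Aa (p′ a Aa e)
      ; <-resp-≈ = (λ { refl p → p }) , λ { refl p → p }
      }
    go : ∀ h → Q h → Acc (λ g h → h ⊏ g) h →
      ¬ ¬ ∃ λ m → Q m × Below h m × (∀ g → Q g → Below m g → Below g m)
    go h Qh (acc rs) K = K (h , Qh , (λ a Aa e → e) , λ g Qg h≤g a Aa ag → reductio _ λ ah →
      go g Qg (rs (h≤g , λ g≤h → no-both (a h == k h) ah (g≤h a Aa ag))) λ (m , Qm , g≤m , max) →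
        K (m , Qm , (λ a Aa e → g≤m a Aa (h≤g a Aa e)) , max))
      where
      no-both : ∀ b → T (not b) → T b → ⊥
      no-both false _ ()

flip-between : ∀ {n} (x y : Pt n) t → T (x t ⊕ y t) → btw x (flip t x) y
flip-between x y t h c = taut 3 (λ x y δ → (δ ⇒ x ⊕ y) ∷ [] ⊢ bt x (x ⊕ δ) y)
  (x c) (y c) (δ t c) (at (λ c → x c ⊕ y c) t h c)

nonconst : Bool → Bool → Bool → Bool
nonconst u v w = not (u == v ∧ u == w)

off : Bool → Bool → Bool → Bool
off v w y = v == w ∧ y ⊕ v

module _ {n : ℕ} {P : Pt n → Set} (resp : ∀ {x y} → x ≈ y → P x → P y)
  (iso : Isometric P) (hph : HereditaryPreHull P) where

  -- One component for each descent: the dimension of the box falls when `u` is replaced by `s′`,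
  -- the length of the base I(v,w) falls in `shrink`, the directions in which `y` lies off the base
  -- decrease in `advance`, and the last two pay for a step of `y` towards `w` and a step of `u`
  -- towards `y`.
  measure : Pt n → Pt n → Pt n → Pt n → Vec ℕ 5
  measure u v w y = count (λ c → nonconst (u c) (v c) (w c)) ∷ d v w ∷
    count (λ c → off (v c) (w c) (y c)) ∷ d y w ∷ d u y ∷ []

  Solved : Pt n → Pt n → Pt n → Pt n → Set
  Solved u v w y = P u → P v → P w → P y → Box u v w y → ¬ ¬ ∃ λ z → P z × btw v z w × btw u y z

  module Unsolved (u v w y : Pt n) (Pu : P u) (Pv : P v) (Pw : P w) (Py : P y) (box : Box u v w y)
    (ih : ∀ u′ v′ w′ y′ → measure u′ v′ w′ y′ ≺ measure u v w y → Solved u′ v′ w′ y′)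
    (unsolved : ∀ z → P z → btw v z w → ¬ btw u y z) where

    module Neighbour (e : Fin n) (ywe : T (y e ⊕ w e)) (Px : P (flip e y)) (w′ : Pt n) (Pw′ : P w′)
      (vw′w : btw v w′ w) (uxw′ : btw u (flip e y) w′) where

      x : Pt n
      x = flip e y

      -- As `x` and `y` differ only at `e`, the point `y` can miss I(u,w′) only if `u` and `w′` both
      -- have the bit of `x` there. This gives `w′e` and `ue`.
      w′e : T (w′ e ⊕ y e)
      w′e = reductio _ λ h → unsolved w′ Pw′ vw′w λ c →
        taut 4 (λ u y w′ δ → bt u (y ⊕ δ) w′ ∷ (δ ⇒ not (w′ ⊕ y)) ∷ [] ⊢ bt u y w′)
          (u c) (y c) (w′ c) (δ e c) (uxw′ c) (at (λ c → not (w′ c ⊕ y c)) e h c)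

      ue : T (u e ⊕ y e)
      ue = reductio _ λ h → unsolved w′ Pw′ vw′w λ c →
        taut 4 (λ u y w′ δ → bt u (y ⊕ δ) w′ ∷ (δ ⇒ not (u ⊕ y)) ∷ [] ⊢ bt u y w′)
          (u c) (y c) (w′ c) (δ e c) (uxw′ c) (at (λ c → not (u c ⊕ y c)) e h c)

      ve : T (v e == y e)
      ve = taut 4 (λ u v w y → bx u v w y ∷ y ⊕ w ∷ u ⊕ y ∷ [] ⊢ v == y)
        (u e) (v e) (w e) (y e) (box e) ywe ue

      module Second (t : Fin n) (uxt : T (u t ⊕ flip e y t)) (Pu₁ : P (flip t u)) (k : Pt n) (Pk : P k)
        (vkw : btw v k w) (u₁yk : btw (flip t u) y k) where

        t≢e : t ≢ e
        t≢e refl = taut 3 (λ u y δ → δ ∷ u ⊕ y ∷ u ⊕ (y ⊕ δ) ∷ [] ⊢ false)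
          (u e) (y e) (δ e e) (δ-refl e) ue uxt

        e≢t : e ≢ t
        e≢t p = t≢e (sym p)

        ut : T (u t ⊕ y t)
        ut = taut 3 (λ u y δ → not δ ∷ u ⊕ (y ⊕ δ) ∷ [] ⊢ u ⊕ y)
          (u t) (y t) (δ e t) (δ-≢ e≢t) uxt

        kt : T (k t ⊕ y t)
        kt = reductio _ λ h → unsolved k Pk vkw λ c →
          taut 4 (λ u y k δ → bt (u ⊕ δ) y k ∷ (δ ⇒ not (k ⊕ y)) ∷ [] ⊢ bt u y k)
            (u c) (y c) (k c) (δ t c) (u₁yk c) (at (λ c → not (k c ⊕ y c)) t h c)

        ke : T (k e == y e)
        ke = taut 4 (λ u y k δ → not δ ∷ bt (u ⊕ δ) y k ∷ u ⊕ y ∷ [] ⊢ k == y)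
          (u e) (y e) (k e) (δ t e) (δ-≢ t≢e) (u₁yk e) ue

        w′t : T (w′ t == y t)
        w′t = taut 4 (λ u y w δ → not δ ∷ bt u (y ⊕ δ) w ∷ u ⊕ y ∷ [] ⊢ w == y)
          (u t) (y t) (w′ t) (δ e t) (δ-≢ e≢t) (uxw′ t) ut

        ekw : T (k e ⊕ w′ e)
        ekw = taut 3 (λ k w y → k == y ∷ w ⊕ y ∷ [] ⊢ k ⊕ w) (k e) (w′ e) (y e) ke w′e

        within : ∀ a b z → btw v a w → btw v b w → btw a z b → btw v z w
        within a b z va vb az c = taut 5 (λ v w a b z → bt v a w ∷ bt v b w ∷ bt a z b ∷ [] ⊢ bt v z w)
          (v c) (w c) (a c) (b c) (z c) (va c) (vb c) (az c)

        -- A pair of points of I(v,w) that still spans y must be antipodal in I(v,w).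
        shrink : ∀ a b → P a → P b → btw v a w → btw v b w → Box u a b y →
          ∀ c → T (v c ⊕ w c ⇒ a c ⊕ b c)
        shrink a b Pa Pb va vb bx′ c = reductio _ λ h → ih u a b y
          (inj₂ (count-mono _ _ (λ c →
              taut 5 (λ u v w a b → bt v a w ∷ bt v b w ∷ [] ⊢ nonconst u a b ⇒ nonconst u v w)
                (u c) (v c) (w c) (a c) (b c) (va c) (vb c)) ,
            inj₁ (count-strict (λ c → a c ⊕ b c) (λ c → v c ⊕ w c)
              (λ c → taut 4 (λ v w a b → bt v a w ∷ bt v b w ∷ [] ⊢ a ⊕ b ⇒ v ⊕ w)
                (v c) (w c) (a c) (b c) (va c) (vb c)) c
              (taut 2 (λ p q → not (p ⇒ q) ∷ [] ⊢ not q) (v c ⊕ w c) (a c ⊕ b c) h)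
              (taut 2 (λ p q → not (p ⇒ q) ∷ [] ⊢ p) (v c ⊕ w c) (a c ⊕ b c) h))))
          Pu Pa Pb Py bx′ λ (z , Pz , azb , uyz) → unsolved z Pz (within a b z va vb azb) uyz

        -- Already `x` lies on I(u,w′), and the one bit in which `y` differs from `x` is supplied by
        -- `z`.
        box-from : ∀ z → T (z e == y e) → Box u z w′ y
        box-from z ze c = taut 5 (λ u y z w δ → bt u (y ⊕ δ) w ∷ (δ ⇒ u ⊕ y) ∷ (δ ⇒ z == y) ∷ [] ⊢ bx u z w y)
          (u c) (y c) (z c) (w′ c) (δ e c) (uxw′ c) (at (λ c → u c ⊕ y c) e ue c) (at (λ c → z c == y c) e ze c)

        boxF : Box u k w′ y
        boxF = box-from k ke

        antipodal : ∀ c → T (v c ⊕ w c ⇒ k c ⊕ w′ c)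
        antipodal = shrink k w′ Pk Pw′ vkw vw′w boxF

        const : ∀ c → T (k c == w′ c ⇒ v c == w c ∧ v c == k c)
        const c = taut 4 (λ v w k w′ → bt v k w ∷ (v ⊕ w ⇒ k ⊕ w′) ∷ [] ⊢ k == w′ ⇒ v == w ∧ v == k)
          (v c) (w c) (k c) (w′ c) (vkw c) (antipodal c)

        -- By `box-from` such a `z` spans `y` together with `u` and `w′`, so `shrink` makes it
        -- antipodal to `w′` in I(v,w), and that antipode is `k`.
        corner-unique : ∀ z → P z → btw k z w′ → T (z e == y e) → z ≈ k
        corner-unique z Pz kzw ze c = taut 5 (λ v w k w′ z → bt v k w ∷ bt v w′ w ∷ bt k z w′ ∷ (v ⊕ w ⇒ z ⊕ w′) ∷ [] ⊢ z == k)
          (v c) (w c) (k c) (w′ c) (z c) (vkw c) (vw′w c) (kzw c)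
          (shrink z w′ Pz Pw′ (within k w′ z vkw vw′w kzw) vw′w (box-from z ze) c)

        -- The missing quadrant: in the directions `e` and `t`, `k` and `w′` lie in the two
        -- quadrants next to that of `y`, which contains no point of I(k,w′).
        no-corner : ∀ z → P z → btw k z w′ → T (z e == y e) → ¬ T (z t == y t)
        no-corner z Pz kzw ze = taut 3 (λ k y z → z == k ∷ k ⊕ y ∷ z == y ∷ [] ⊢ false)
          (k t) (y t) (z t) (corner-unique z Pz kzw ze t) kt

        -- A first step from `k` towards `w′` in a direction other than `e` would keep the bit at
        -- `e` and contradict `corner-unique`.
        k-crosses : ¬ ¬ P (flip e k)
        k-crosses K = iso k w′ Pk Pw′ e ekw λ (r , kwr , Pr) → go r kwr Pr
          where
          go : ∀ r → T (k r ⊕ w′ r) → P (flip r k) → ⊥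
          go r kwr Pr with r Fin.≟ e
          ... | yes refl = K Pr
          ... | no r≢e = taut 2 (λ k δ → δ ∷ (k ⊕ δ) == k ∷ [] ⊢ false) (k r) (δ r r) (δ-refl r)
            (corner-unique (flip r k) Pr (flip-between k w′ r kwr)
              (taut 3 (λ k y δ → not δ ∷ k == y ∷ [] ⊢ (k ⊕ δ) == y) (k e) (y e) (δ r e) (δ-≢ r≢e) ke) r)

        module Crossed (Pk* : P (flip e k)) where

          k* : Pt n
          k* = flip e k

          maskA maskE : Pt n
          maskA c = u c == k c ∧ u c == w′ c
          maskE c = maskA c ∨ δ e c

          -- `Whole` is the box of `u`, `k`, `w′`, and `Slice` its half on the side of `u` at `e`.
          -- The slice contains `u`, `x`, `w′` and `k*`, but neither `y` nor `k`.
          Whole Slice : Pt n → Set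
          Whole = Face P maskA u
          Slice = Face P maskE u

          isoA : Isometric Whole
          isoA = Face-isometric iso maskA u

          isoE : Isometric Slice
          isoE = Face-isometric iso maskE u

          Au : Whole u
          Au = Pu , λ c → taut 2 (λ u m → [] ⊢ m ⇒ u == u) (u c) (maskA c)

          Ay : Whole y
          Ay = Py , λ c → taut 4 (λ u k w y → bx u k w y ∷ [] ⊢ u == k ∧ u == w ⇒ y == u)
            (u c) (k c) (w′ c) (y c) (boxF c)

          Ak : Whole k
          Ak = Pk , λ c → taut 3 (λ u k w → [] ⊢ u == k ∧ u == w ⇒ k == u) (u c) (k c) (w′ c)

          Aw′ : Whole w′
          Aw′ = Pw′ , λ c → taut 3 (λ u k w → [] ⊢ u == k ∧ u == w ⇒ w == u) (u c) (k c) (w′ c)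

          E⊆A : ∀ {a} → Slice a → Whole a
          E⊆A {a} (Pa , Fa) = Pa , λ c → taut 4 (λ m δ a u → (m ∨ δ ⇒ a == u) ∷ [] ⊢ m ⇒ a == u)
            (maskA c) (δ e c) (a c) (u c) (Fa c)

          A⊆E : ∀ {a} → Whole a → T (a e == u e) → Slice a
          A⊆E {a} (Pa , Fa) ae = Pa , λ c →
            taut 4 (λ m δ a u → (m ⇒ a == u) ∷ (δ ⇒ a == u) ∷ [] ⊢ m ∨ δ ⇒ a == u)
              (maskA c) (δ e c) (a c) (u c) (Fa c) (at (λ c → a c == u c) e ae c)

          flipE : ∀ {a} → Whole a → P (flip e a) → T (a e ⊕ u e) → Slice (flip e a)
          flipE {a} (Pa , Fa) Pa′ ae = Pa′ , λ c →
            taut 4 (λ m δ a u → (m ⇒ a == u) ∷ (δ ⇒ a ⊕ u) ∷ [] ⊢ m ∨ δ ⇒ (a ⊕ δ) == u)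
              (maskA c) (δ e c) (a c) (u c) (Fa c) (at (λ c → a c ⊕ u c) e ae c)

          Eu : Slice u
          Eu = A⊆E Au (==-refl (u e))

          Ex : Slice x
          Ex = flipE Ay Px (taut 2 (λ u y → u ⊕ y ∷ [] ⊢ y ⊕ u) (u e) (y e) ue)

          Ew′ : Slice w′
          Ew′ = A⊆E Aw′ (taut 3 (λ u y w → u ⊕ y ∷ w ⊕ y ∷ [] ⊢ w == u) (u e) (y e) (w′ e) ue w′e)

          Ek* : Slice k*
          Ek* = flipE Ak Pk* (taut 3 (λ u y k → u ⊕ y ∷ k == y ∷ [] ⊢ k ⊕ u) (u e) (y e) (k e) ue ke)

          -- A direction h stands for the half-space around k that it cuts off.
          Hidden : Fin n → Set
          Hidden h = T (k h == w′ h ∧ u h ⊕ k h ∧ y h == u h)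

          Shown : Fin n → Set
          Shown g = T (k g == w′ g ∧ u g ⊕ k g ∧ y g == k g)

          -- The way from `a` to `b` crosses `m` at an end, where the bit `c` has already changed;
          -- on a shortest way it does not change back.
          far-side : ∀ a b → Whole a → Whole b → ∀ m c → (∀ s → Ends Whole m (u m) s → T (s c ⊕ a c)) →
            T (a m == u m) → T (u m ⊕ k m) → T (b m == k m) → T (b c ⊕ a c)
          far-side a b Aa Ab m c sep am um bm = reductio _ λ h →
            crossing isoA m a b Aa Ab
              (taut 4 (λ a b u k → a == u ∷ u ⊕ k ∷ b == k ∷ [] ⊢ a ⊕ b) (a m) (b m) (u m) (k m) am um bm)
              λ (s , As , As′ , sm , asb) →
                taut 3 (λ a b s → bt a s b ∷ not (b ⊕ a) ∷ s ⊕ a ∷ [] ⊢ false) (a c) (b c) (s c) (asb c) h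
                  (sep s (As , As′ , taut 3 (λ s a u → s == a ∷ a == u ∷ [] ⊢ s == u) (s m) (a m) (u m) sm am))

          module Maximal (m : Fin n) (hidden : Hidden m)
            (max : ∀ g → Hidden g → Below Whole k m g → Below Whole k g m) where

            km : T (k m == w′ m)
            km = taut 4 (λ k w u y → k == w ∧ u ⊕ k ∧ y == u ∷ [] ⊢ k == w) (k m) (w′ m) (u m) (y m) hidden

            um : T (u m ⊕ k m)
            um = taut 4 (λ k w u y → k == w ∧ u ⊕ k ∧ y == u ∷ [] ⊢ u ⊕ k) (k m) (w′ m) (u m) (y m) hidden

            ym : T (y m == u m)
            ym = taut 4 (λ k w u y → k == w ∧ u ⊕ k ∧ y == u ∷ [] ⊢ y == u) (k m) (w′ m) (u m) (y m) hidden

            wm : T (w′ m == k m)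
            wm = taut 2 (λ k w → k == w ∷ [] ⊢ w == k) (k m) (w′ m) km

            -- A direction `c` separating the ends from `y` would be hidden, with a half-space
            -- containing that of `m`. By maximality the two half-spaces would coincide, yet any end
            -- lies in the former and not in the latter.
            hull-y : Hull (Ends Whole m (u m)) y
            hull-y c sep = crossing isoA m u k Au Ak um λ (s , As , As′ , sm , _) →
              taut 3 (λ s u k → s == u ∷ u ⊕ k ∷ s == k ∷ [] ⊢ false) (s m) (u m) (k m) sm um
                (max c hidden-c below s As
                  (taut 3 (λ s y k → s ⊕ y ∷ k ⊕ y ∷ [] ⊢ s == k) (s c) (y c) (k c) (sep s (As , As′ , sm)) kc))
              where
              kc : T (k c ⊕ y c)
              kc = far-side y k Ay Ak m c sep ym um (==-refl (k m))
              hidden-c : Hidden c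
              hidden-c = taut 4 (λ k w u y → k ⊕ y ∷ w ⊕ y ∷ bx u k w y ∷ [] ⊢ k == w ∧ u ⊕ k ∧ y == u)
                (k c) (w′ c) (u c) (y c) kc (far-side y w′ Ay Aw′ m c sep ym um wm) (boxF c)
              below : Below Whole k m c
              below a Aa am = taut 3 (λ a y k → a ⊕ y ∷ k ⊕ y ∷ [] ⊢ a == k) (a c) (y c) (k c)
                (far-side y a Ay Aa m c sep ym um am) kc

            -- Otherwise `u` is in the hull of the ends too, and the pre-hull property of `Whole`
            -- lets `y` be pushed away from `u` across `m`.
            escape : ¬ ¬ ∃ λ g → Shown g × Below Whole k m g
            escape K = hph maskA u m (u m) u y Au Ay hull-u hull-y
              λ (s , (As , As′ , sm) , usy) → advance s As As′ sm usy
              where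
              hull-u : Hull (Ends Whole m (u m)) u
              hull-u c sep = hull-y c λ s Es → reductio _ λ h → K (c ,
                taut 4 (λ k w u y → k ⊕ u ∷ w ⊕ u ∷ y ⊕ u ∷ [] ⊢ k == w ∧ u ⊕ k ∧ y == k)
                  (k c) (w′ c) (u c) (y c) kc wc
                  (taut 3 (λ s u y → s ⊕ u ∷ not (s ⊕ y) ∷ [] ⊢ y ⊕ u) (s c) (u c) (y c) (sep s Es) h) ,
                λ a Aa am → taut 3 (λ a u k → a ⊕ u ∷ k ⊕ u ∷ [] ⊢ a == k) (a c) (u c) (k c)
                  (far-side u a Au Aa m c sep (==-refl (u m)) um am) kc)
                where
                kc : T (k c ⊕ u c)
                kc = far-side u k Au Ak m c sep (==-refl (u m)) um (==-refl (k m))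
                wc : T (w′ c ⊕ u c)
                wc = far-side u w′ Au Aw′ m c sep (==-refl (u m)) um wm
              -- Since `y′` lies beyond `y` as seen from `u`, a solution for `y′` also solves `y`.
              -- And `y′` has crossed to the side of `k` and `w′`, so `m` is no longer counted by
              -- `off`.
              advance : ∀ s → Whole s → Whole (flip m s) → T (s m == u m) → btw u y s → ⊥
              advance s As As′ sm usy = ih u k w′ y′
                (inj₂ (count-mono _ _ (λ c → taut 5
                    (λ u v w k w′ → bt v k w ∷ bt v w′ w ∷ [] ⊢ nonconst u k w′ ⇒ nonconst u v w)
                    (u c) (v c) (w c) (k c) (w′ c) (vkw c) (vw′w c)) ,
                 inj₂ (count-mono _ _ (λ c → taut 4
                    (λ v w k w′ → bt v k w ∷ bt v w′ w ∷ [] ⊢ k ⊕ w′ ⇒ v ⊕ w)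
                    (v c) (w c) (k c) (w′ c) (vkw c) (vw′w c)) ,
                 inj₁ (count-strict (λ c → off (k c) (w′ c) (y′ c)) (λ c → off (v c) (w c) (y c))
                   (λ c → taut 7 (λ u v w k w′ y y′ → (k == w′ ⇒ v == w ∧ v == k) ∷
                       (u == k ∧ u == w′ ⇒ y′ == u) ∷ bt u y y′ ∷ [] ⊢ off k w′ y′ ⇒ off v w y)
                     (u c) (v c) (w c) (k c) (w′ c) (y c) (y′ c) (const c) (proj₂ As′ c) (uyy′ c))
                   m
                   (taut 5 (λ k w u s δ → δ ∷ s == u ∷ u ⊕ k ∷ [] ⊢ not (off k w (s ⊕ δ)))
                     (k m) (w′ m) (u m) (s m) (δ m m) (δ-refl m) sm um)
                   (taut 6 (λ u v w k w′ y → (k == w′ ⇒ v == w ∧ v == k) ∷ k == w′ ∷ u ⊕ k ∷ y == u ∷ [] ⊢ off v w y)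
                     (u m) (v m) (w m) (k m) (w′ m) (y m) (const m) km um ym)))))
                Pu Pk Pw′ (proj₁ As′)
                (λ c → taut 4 (λ u k w y′ → (u == k ∧ u == w ⇒ y′ == u) ∷ [] ⊢ bx u k w y′)
                  (u c) (k c) (w′ c) (y′ c) (proj₂ As′ c))
                λ (z , Pz , kzw , uy′z) → unsolved z Pz (within k w′ z vkw vw′w kzw) λ c →
                  taut 4 (λ u y y′ z → bt u y y′ ∷ bt u y′ z ∷ [] ⊢ bt u y z)
                    (u c) (y c) (y′ c) (z c) (uyy′ c) (uy′z c)
                where
                y′ : Pt n
                y′ = flip m s
                uyy′ : btw u y y′
                uyy′ c = taut 4 (λ u y s δ → bt u y s ∷ (δ ⇒ s == u) ∷ [] ⊢ bt u y (s ⊕ δ))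
                  (u c) (y c) (s c) (δ m c) (usy c) (at (λ c → s c == u c) m sm c)

          -- A half-space around `k` and `w′` that misses `u` and `y` can be enlarged to contain `y`
          -- while still missing `u`. In `box′` this keeps `y` inside the box of the new apex.
          reveal : ∀ h → Hidden h → ¬ ¬ ∃ λ g → Shown g × Below Whole k h g
          reveal h Hh K = maximal Whole k Hidden h Hh λ (m , Hm , h≤m , max) →
            Maximal.escape m Hm max λ (g , Sg , m≤g) → K (g , Sg , λ a Aa e → m≤g a Aa (h≤m a Aa e))

          Separating : Fin n → Set
          Separating j = T (k* j == w′ j ∧ u j ⊕ w′ j)

          Top : Fin n → Set
          Top j = Separating j × (∀ g → Separating g → Below Slice k* j g → Below Slice k* g j)

          module _ {j : Fin n} (sj : Separating j) where

            k*w : T (k* j == w′ j)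
            k*w = taut 3 (λ k w u → k == w ∧ u ⊕ w ∷ [] ⊢ k == w) (k* j) (w′ j) (u j) sj

            uw : T (u j ⊕ w′ j)
            uw = taut 3 (λ k w u → k == w ∧ u ⊕ w ∷ [] ⊢ u ⊕ w) (k* j) (w′ j) (u j) sj

            j≢e : j ≢ e
            j≢e refl = taut 4 (λ k y w u → u ⊕ y ∷ w ⊕ y ∷ u ⊕ w ∷ [] ⊢ false)
              (k e) (y e) (w′ e) (u e) ue w′e uw

            j≢t : j ≢ t
            j≢t refl = taut 4 (λ k y w δ → not δ ∷ k ⊕ y ∷ w == y ∷ (k ⊕ δ) == w ∷ [] ⊢ false)
              (k t) (y t) (w′ t) (δ e t) (δ-≢ e≢t) kt w′t k*w

            kj : T (k j == w′ j)
            kj = taut 3 (λ k w δ → not δ ∷ (k ⊕ δ) == w ∷ [] ⊢ k == w) (k j) (w′ j) (δ e j) (δ-≢ (λ p → j≢e (sym p))) k*w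

            yx : T (x j == w′ j) → T (y j == w′ j)
            yx = taut 3 (λ y w δ → not δ ∷ (y ⊕ δ) == w ∷ [] ⊢ y == w) (y j) (w′ j) (δ e j) (δ-≢ (λ p → j≢e (sym p)))

          shown⇒separating : ∀ g → Shown g → Separating g × T (x g == w′ g)
          shown⇒separating g sg =
            taut 5 (λ k w u y δ → (δ ⇒ k ⊕ w) ∷ k == w ∧ u ⊕ k ∧ y == k ∷ [] ⊢ (k ⊕ δ) == w ∧ u ⊕ w)
              (k g) (w′ g) (u g) (y g) (δ e g) off-e sg ,
            taut 5 (λ k w u y δ → (δ ⇒ k ⊕ w) ∷ k == w ∧ u ⊕ k ∧ y == k ∷ [] ⊢ (y ⊕ δ) == w)
              (k g) (w′ g) (u g) (y g) (δ e g) off-e sg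
            where
            off-e : T (δ e g ⇒ k g ⊕ w′ g)
            off-e = at (λ c → k c ⊕ w′ c) e ekw g

          top-above : ∀ g → Separating g → T (x g == w′ g) →
            ¬ ¬ ∃ λ j → Top j × T (x j == w′ j) × Below Slice k* g j
          top-above g sg xg K = maximal Slice k* Separating g sg λ (j , sj , g≤j , max) →
            K (j , (sj , max) ,
              taut 3 (λ x k w → x == k ∷ k == w ∷ [] ⊢ x == w) (x j) (k* j) (w′ j)
                (g≤j x Ex (taut 3 (λ x k w → x == w ∷ k == w ∷ [] ⊢ x == k) (x g) (k* g) (w′ g) xg (k*w sg))) (k*w sj) ,
              g≤j)

          -- If no half-space contained `k` and `w′` but not `u`, then `y` would lie on I(k,w′),
          -- hence on I(v,w), and would itself be a solution.
          some-top : ¬ ¬ ∃ λ j → Top j × T (x j == w′ j)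
          some-top K = counterexample (λ c → k c == w′ c ⇒ u c == k c)
            (λ h → unsolved y Py
              (within k w′ y vkw vw′w λ c → taut 4
                (λ u k w y → (k == w ⇒ u == k) ∷ bx u k w y ∷ [] ⊢ bt k y w)
                (u c) (k c) (w′ c) (y c) (h c) (boxF c))
              (btw-refl u y))
            λ (c , h) → [ (λ yk → shown c (taut 4
                  (λ u k w y → not (k == w ⇒ u == k) ∷ y == k ∷ [] ⊢ k == w ∧ u ⊕ k ∧ y == k)
                  (u c) (k c) (w′ c) (y c) h yk))
              , (λ yk → reveal c (taut 4
                  (λ u k w y → not (k == w ⇒ u == k) ∷ not (y == k) ∷ [] ⊢ k == w ∧ u ⊕ k ∧ y == u)
                  (u c) (k c) (w′ c) (y c) h yk) λ (g , sg , _) → shown g sg)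
              ]′ (decide (y c == k c))
            where
            shown : ∀ g → Shown g → ⊥
            shown g sg = top-above g (proj₁ (shown⇒separating g sg)) (proj₂ (shown⇒separating g sg))
              λ (j , tj , xj , _) → K (j , tj , xj)

          u₁ : Pt n
          u₁ = flip t u

          Eu₁ : Slice u₁
          Eu₁ = Pu₁ , λ c → taut 6
            (λ u y k w δ δ′ → (δ ⇒ u ⊕ y) ∷ (δ ⇒ w == y) ∷ (δ ⇒ not δ′) ∷ [] ⊢ u == k ∧ u == w ∨ δ′ ⇒ (u ⊕ δ) == u)
            (u c) (y c) (k c) (w′ c) (δ t c) (δ e c)
            (at (λ c → u c ⊕ y c) t ut c) (at (λ c → w′ c == y c) t w′t c) (δ-off c t≢e)

          respE : ∀ {a b} → a ≈ b → Slice a → Slice b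
          respE {a} {b} ab (Pa , Fa) = resp ab Pa , λ c →
            taut 4 (λ m a b u → a == b ∷ (m ⇒ a == u) ∷ [] ⊢ m ⇒ b == u) (maskE c) (a c) (b c) (u c) (ab c) (Fa c)

          Passed : Pt n → Fin n → Set
          Passed p j = ∀ j′ → Top j′ → T (x j′ == w′ j′) → j′ ≢ j → T (p j′ == w′ j′)

          -- Traced backwards from `x`, which lies in all the half-spaces in question, to `u₁`,
          -- which lies in none: the first exit is the last entry. Starting the way at `u₁` instead
          -- of `u` ensures that `p` has the bit of `y` at `t`.
          last-entry : ¬ ¬ ∃ λ p → ∃ λ j → Slice p × Slice (flip j p) × Top j × T (x j == w′ j) ×
            T (p j ⊕ w′ j) × btw u₁ p x × Passed p j
          last-entry K = some-top λ (j₀ , tj₀ , xj₀) →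
            go j₀ tj₀ xj₀ x Ex (btw-refl u₁ x) (λ j _ xj → xj) (<-wellFounded (d x u₁))
            where
            go : ∀ j₀ → Top j₀ → T (x j₀ == w′ j₀) → ∀ a → Slice a → btw u₁ a x →
              (∀ j → Top j → T (x j == w′ j) → T (a j == w′ j)) → Acc _<_ (d a u₁) → ⊥
            go j₀ tj₀ xj₀ a Ea u₁ax inside (acc rs) = isoE a u₁ Ea Eu₁ j₀
              (taut 4 (λ a u w δ → not δ ∷ u ⊕ w ∷ a == w ∷ [] ⊢ a ⊕ (u ⊕ δ)) (a j₀) (u j₀) (w′ j₀) (δ t j₀)
                (δ-≢ (λ p → j≢t (proj₁ tj₀) (sym p))) (uw (proj₁ tj₀)) (inside j₀ tj₀ xj₀))
              λ (r , ar , Ea′) → excluded-middle (Top r × T (x r == w′ r)) λ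
                { (inj₁ (tr , xr)) → K (flip r a , r , Ea′ ,
                    respE (λ c → taut 2 (λ a δ → [] ⊢ a == ((a ⊕ δ) ⊕ δ)) (a c) (δ r c)) Ea , tr , xr ,
                    taut 3 (λ a w δ → δ ∷ a == w ∷ [] ⊢ (a ⊕ δ) ⊕ w) (a r) (w′ r) (δ r r) (δ-refl r) (inside r tr xr) ,
                    back r ar , λ j tj xj j≢r → still r j tj xj (λ p → j≢r (sym p)))
                ; (inj₂ ¬top) → go j₀ tj₀ xj₀ (flip r a) Ea′ (back r ar)
                    (λ j tj xj → still r j tj xj (λ { refl → ¬top (tj , xj) })) (rs (closer a u₁ r ar)) }
              where
              back : ∀ r → T (a r ⊕ u₁ r) → btw u₁ (flip r a) x
              back r ar c = taut 4 (λ u a x δ → bt u a x ∷ (δ ⇒ a ⊕ u) ∷ [] ⊢ bt u (a ⊕ δ) x)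
                (u₁ c) (a c) (x c) (δ r c) (u₁ax c) (at (λ c → a c ⊕ u₁ c) r ar c)
              still : ∀ r j → Top j → T (x j == w′ j) → r ≢ j → T (flip r a j == w′ j)
              still r j tj xj r≢j = taut 3 (λ a w δ → not δ ∷ a == w ∷ [] ⊢ (a ⊕ δ) == w)
                (a j) (w′ j) (δ r j) (δ-≢ r≢j) (inside j tj xj)

          contradiction : ⊥
          contradiction = last-entry λ (p , j , Ep , Ep′ , tj , xj , pj , u₁px , passed) →
            Finish.done p j Ep Ep′ tj xj pj u₁px passed
            where
            module Finish (p : Pt n) (j : Fin n) (Ep : Slice p) (Ep′ : Slice (flip j p)) (tj : Top j)
              (xj : T (x j == w′ j)) (pj : T (p j ⊕ w′ j)) (u₁px : btw u₁ p x) (passed : Passed p j) where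

              sj : Separating j
              sj = proj₁ tj

              Ends-p : Ends Slice j (u j) p
              Ends-p = Ep , Ep′ , taut 3 (λ p w u → p ⊕ w ∷ u ⊕ w ∷ [] ⊢ p == u) (p j) (w′ j) (u j) pj (uw sj)

              hull-p : Hull (Ends Slice j (u j)) p
              hull-p c sep = taut 1 (λ p → p ⊕ p ∷ [] ⊢ false) (p c) (sep p Ends-p)

              -- The argument of `hull-y` for a maximal half-space of the slice, with `p` as the end
              -- that tells the two half-spaces apart.
              hull-u : Hull (Ends Slice j (u j)) u
              hull-u c sep = taut 3 (λ p k w → p ⊕ w ∷ k == w ∷ p == k ∷ [] ⊢ false) (p j) (k* j) (w′ j) pj (k*w sj)
                (proj₂ tj c
                  (taut 3 (λ k w u → k ⊕ u ∷ w ⊕ u ∷ [] ⊢ k == w ∧ u ⊕ w) (k* c) (w′ c) (u c) kc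
                    (far w′ Ew′ (taut 2 (λ k w → k == w ∷ [] ⊢ w == k) (k* j) (w′ j) (k*w sj))))
                  (λ a Ea aj → to-k* a (far a Ea aj))
                  p Ep (to-k* p (sep p Ends-p)))
                where
                far : ∀ a → Slice a → T (a j == k* j) → T (a c ⊕ u c)
                far a Ea aj = reductio _ λ h → crossing isoE j u a Eu Ea
                  (taut 4 (λ u w k a → u ⊕ w ∷ k == w ∷ a == k ∷ [] ⊢ u ⊕ a) (u j) (w′ j) (k* j) (a j) (uw sj) (k*w sj) aj)
                  λ (s , Es , Es′ , sm , usa) →
                    taut 3 (λ u a s → bt u s a ∷ not (a ⊕ u) ∷ s ⊕ u ∷ [] ⊢ false) (u c) (a c) (s c) (usa c) h
                      (sep s (Es , Es′ , sm))
                kc : T (k* c ⊕ u c)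
                kc = far k* Ek* (==-refl (k* j))
                to-k* : ∀ a → T (a c ⊕ u c) → T (a c == k* c)
                to-k* a h = taut 3 (λ a u k → a ⊕ u ∷ k ⊕ u ∷ [] ⊢ a == k) (a c) (u c) (k* c) h kc

              module Partner (s : Pt n) (Es : Slice s) (Es′ : Slice (flip j s)) (sju : T (s j == u j)) (pus : btw p u s) where

                s′ : Pt n
                s′ = flip j s

                -- If `y` were outside in a direction `c`, then `c` would be hidden with `s` in its
                -- half-space, so `s` would lie in some maximal half-space containing `x`. It is not
                -- that of `j`, and any other already contains `p`, hence also `u`, which lies
                -- between `p` and `s`: impossible.
                box′ : Box s′ k w′ y
                box′ c with j Fin.≟ c
                ... | yes refl = taut 4 (λ s k w y → y == w ∷ [] ⊢ bx s k w y) (s j ⊕ true) (k j) (w′ j) (y j) (yx sj xj)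
                ... | no j≢c = reductio _ λ h →
                  reveal c
                    (taut 5 (λ u s k w y → bx u k w y ∷ not (bx (s ⊕ false) k w y) ∷ [] ⊢ k == w ∧ u ⊕ k ∧ y == u)
                      (u c) (s c) (k c) (w′ c) (y c) (boxF c) h)
                    λ (g , sg , c≤g) → top-above g (proj₁ (shown⇒separating g sg)) (proj₂ (shown⇒separating g sg))
                      λ (j′ , tj′ , xj′ , g≤j′) → clash j′ tj′ xj′ (g≤j′ s Es
                        (taut 4 (λ s k w d → s == k ∷ k == w ∷ (k ⊕ d) == w ∷ [] ⊢ s == (k ⊕ d)) (s g) (k g) (w′ g) (δ e g)
                          (c≤g s (E⊆A Es) (taut 4 (λ s k w y → not (bx (s ⊕ false) k w y) ∷ [] ⊢ s == k)
                            (s c) (k c) (w′ c) (y c) h))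
                          (kj (proj₁ (shown⇒separating g sg))) (k*w (proj₁ (shown⇒separating g sg)))))
                  where
                  clash : ∀ j′ → Top j′ → T (x j′ == w′ j′) → T (s j′ == k* j′) → ⊥
                  clash j′ tj′ xj′ sk with j′ Fin.≟ j
                  ... | yes refl = taut 4 (λ s u k w → s == u ∷ s == k ∷ k == w ∷ u ⊕ w ∷ [] ⊢ false)
                    (s j) (u j) (k* j) (w′ j) sju sk (k*w sj) (uw sj)
                  ... | no j′≢j = taut 5 (λ s u k w p → p == w ∷ bt p u s ∷ s == k ∷ k == w ∷ u ⊕ w ∷ [] ⊢ false)
                    (s j′) (u j′) (k* j′) (w′ j′) (p j′) (passed j′ tj′ xj′ j′≢j) (pus j′) sk
                    (k*w (proj₁ tj′)) (uw (proj₁ tj′))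

                s′e : T (s′ e == u e)
                s′e = taut 4 (λ m δ s u → δ ∷ (m ∨ δ ⇒ s == u) ∷ [] ⊢ s == u) (maskA e) (δ e e) (s′ e) (u e)
                  (δ-refl e) (proj₂ Es′ e)

                -- At `t`, `u` differs from `y` while `p` does not; so `s`, which lies beyond `u` as
                -- seen from `p`, has the bit of `u`.
                s′t : T (s′ t ⊕ y t)
                s′t = taut 7 (λ u p y s δ δ′ δ″ → not δ ∷ δ′ ∷ not δ″ ∷ u ⊕ y ∷ bt (u ⊕ δ′) p (y ⊕ δ″) ∷ bt p u s ∷ [] ⊢ (s ⊕ δ) ⊕ y)
                  (u t) (p t) (y t) (s t) (δ j t) (δ t t) (δ e t) (δ-≢ (j≢t sj)) (δ-refl t) (δ-≢ e≢t) ut (u₁px t) (pus t)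

                done : ⊥
                -- The box of `s′`, `k`, `w′` no longer extends in direction `j`. As `s′` differs
                -- from `y` at both `e` and `t`, the resulting `z` falls into the missing quadrant.
                done = ih s′ k w′ y
                  (inj₁ (count-strict (λ c → nonconst (s′ c) (k c) (w′ c)) (λ c → nonconst (u c) (v c) (w c))
                    (λ c → taut 7 (λ u v w k w′ s δ → (u == k ∧ u == w′ ∨ δ ⇒ s == u) ∷ bt v k w ∷ bt v w′ w ∷ [] ⊢
                        nonconst s k w′ ⇒ nonconst u v w)
                      (u c) (v c) (w c) (k c) (w′ c) (s′ c) (δ e c) (proj₂ Es′ c) (vkw c) (vw′w c))
                    j
                    (taut 5 (λ u k w s δ → δ ∷ s == u ∷ u ⊕ w ∷ k == w ∷ [] ⊢ not (nonconst (s ⊕ δ) k w))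
                      (u j) (k j) (w′ j) (s j) (δ j j) (δ-refl j) sju (uw sj) (kj sj))
                    (taut 5 (λ u v w k w′ → bt v w′ w ∷ u ⊕ w′ ∷ [] ⊢ nonconst u v w)
                      (u j) (v j) (w j) (k j) (w′ j) (vw′w j) (uw sj))))
                  (proj₁ Es′) Pk Pw′ Py box′
                  λ (z , Pz , kzw , s′yz) → no-corner z Pz kzw
                    (taut 4 (λ u s y z → s == u ∷ u ⊕ y ∷ bt s y z ∷ [] ⊢ z == y) (u e) (s′ e) (y e) (z e) s′e ue (s′yz e))
                    (taut 3 (λ s y z → s ⊕ y ∷ bt s y z ∷ [] ⊢ z == y) (s′ t) (y t) (z t) s′t (s′yz t))

              done : ⊥
              done = hph maskE u j (u j) p u Ep Eu hull-p hull-u λ (s , (Es , Es′ , sju) , pus) →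
                Partner.done s Es Es′ sju pus

  hereditaryPreHull⇒joinHull : JoinHull P
  hereditaryPreHull⇒joinHull u v w y = go u v w y (≺-wellFounded (measure u v w y))
    where
    go : ∀ u v w y → Acc _≺_ (measure u v w y) → Solved u v w y
    go u v w y (acc rs) Pu Pv Pw Py box K =
      counterexample (λ c → y c == w c)
        (λ h → unsolved w Pw (btw-refl v w) λ c →
          taut 3 (λ u y w → y == w ∷ [] ⊢ bt u y w) (u c) (y c) (w c) (h c))
        λ (c , h) → iso y w Py Pw c (taut 2 (λ y w → not (y == w) ∷ [] ⊢ y ⊕ w) (y c) (w c) h)
          λ (e , ywe , Px) → first e ywe Px
      where
      unsolved : ∀ z → P z → btw v z w → ¬ btw u y z
      unsolved z Pz vzw uyz = K (z , Pz , vzw , uyz)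
      ih : ∀ u′ v′ w′ y′ → measure u′ v′ w′ y′ ≺ measure u v w y → Solved u′ v′ w′ y′
      ih u′ v′ w′ y′ l = go u′ v′ w′ y′ (rs l)
      module U = Unsolved u v w y Pu Pv Pw Py box ih unsolved
      first : ∀ e → T (y e ⊕ w e) → P (flip e y) → ⊥
      first e ywe Px = ih u v w x
        (inj₂ (≤-refl , inj₂ (≤-refl , inj₂ (count-mono _ _ (λ c →
            taut 4 (λ v w y δ → (δ ⇒ y ⊕ w) ∷ [] ⊢ off v w (y ⊕ δ) ⇒ off v w y)
              (v c) (w c) (y c) (δ e c) (at (λ c → y c ⊕ w c) e ywe c)) ,
          inj₁ (closer y w e ywe)))))
        Pu Pv Pw Px
        (λ c → taut 5 (λ u v w y δ → bx u v w y ∷ (δ ⇒ y ⊕ w) ∷ [] ⊢ bx u v w (y ⊕ δ))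
          (u c) (v c) (w c) (y c) (δ e c) (box c) (at (λ c → y c ⊕ w c) e ywe c))
        λ (w′ , Pw′ , vw′w , uxw′) → second w′ Pw′ vw′w uxw′
        where
        x : Pt n
        x = flip e y
        second : ∀ w′ → P w′ → btw v w′ w → btw u x w′ → ⊥
        second w′ Pw′ vw′w uxw′ = counterexample (λ c → u c == x c)
          (λ h → unsolved v Pv (btw-refl′ v w) λ c →
            taut 4 (λ u v y δ → u == (y ⊕ δ) ∷ (δ ⇒ v == y) ∷ [] ⊢ bt u y v)
              (u c) (v c) (y c) (δ e c) (h c) (at (λ c → v c == y c) e N.ve c))
          λ (c , h) → iso u x Pu Px c (taut 2 (λ u x → not (u == x) ∷ [] ⊢ u ⊕ x) (u c) (x c) h)
            λ (t , uxt , Pu₁) → third t uxt Pu₁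
          where
          module N = U.Neighbour e ywe Px w′ Pw′ vw′w uxw′
          third : ∀ t → T (u t ⊕ x t) → P (flip t u) → ⊥
          third t uxt Pu₁ = ih (flip t u) v w y
            (inj₂ (count-mono _ _ (λ c → taut 5
                (λ u v w y δ → bx u v w y ∷ (δ ⇒ u ⊕ y) ∷ [] ⊢ nonconst (u ⊕ δ) v w ⇒ nonconst u v w)
                (u c) (v c) (w c) (y c) (δ t c) (box c) (uy c)) ,
              inj₂ (≤-refl , inj₂ (≤-refl , inj₂ (≤-refl , inj₁ (closer u y t ut))))))
            Pu₁ Pv Pw Py
            (λ c → taut 5 (λ u v w y δ → bx u v w y ∷ (δ ⇒ u ⊕ y) ∷ [] ⊢ bx (u ⊕ δ) v w y)
              (u c) (v c) (w c) (y c) (δ t c) (box c) (uy c))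
            λ (k , Pk , vkw , u₁yk) → let module S = N.Second t uxt Pu₁ k Pk vkw u₁yk in
              S.k-crosses λ Pk* → S.Crossed.contradiction Pk*
            where
            ut : T (u t ⊕ y t)
            ut = taut 3 (λ u y δ → (δ ⇒ u ⊕ y) ∷ u ⊕ (y ⊕ δ) ∷ [] ⊢ u ⊕ y) (u t) (y t) (δ e t)
              (at (λ c → u c ⊕ y c) e N.ue t) uxt
            uy : ∀ c → T (δ t c ⇒ u c ⊕ y c)
            uy = at (λ c → u c ⊕ y c) t ut

-- Nearest ends of the edges in one direction

btw-sym : ∀ {n} (x z y : Pt n) → btw x z y → btw y z x
btw-sym x z y b c = taut 3 (λ x z y → bt x z y ∷ [] ⊢ bt y z x) (x c) (z c) (y c) (b c)

module _ {n : ℕ} {P : Pt n → Set} (iso : Isometric P) (t : Fin n) (β : Bool) where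

  private
    U : Pt n → Set
    U = Ends P t β

  Near : Pt n → Pt n → Set
  Near q a = ∀ s → U s → btw q s a → s ≈ a

  nearest : ∀ q a → U a → ¬ ¬ ∃ λ b → U b × btw q b a × Near q b
  nearest q a Ua = go a Ua (<-wellFounded (d q a))
    where
    go : ∀ a → U a → Acc _<_ (d q a) → ¬ ¬ ∃ λ b → U b × btw q b a × Near q b
    go a Ua (acc rs) K = K (a , Ua , btw-refl q a , λ s Us qsa c → reductio _ λ h →
      go s Us (rs (count-strict _ _
          (λ c → taut 3 (λ q s a → bt q s a ∷ [] ⊢ q ⊕ s ⇒ q ⊕ a) (q c) (s c) (a c) (qsa c)) c
          (taut 3 (λ q s a → bt q s a ∷ not (s == a) ∷ [] ⊢ not (q ⊕ s)) (q c) (s c) (a c) (qsa c) h)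
          (taut 3 (λ q s a → bt q s a ∷ not (s == a) ∷ [] ⊢ q ⊕ a) (q c) (s c) (a c) (qsa c) h)))
        λ (b , Ub , qbs , near) → K (b , Ub ,
          (λ c → taut 4 (λ q b s a → bt q s a ∷ bt q b s ∷ [] ⊢ bt q b a)
            (q c) (b c) (s c) (a c) (qsa c) (qbs c)) ,
          near))

  module _ (jh : JoinHull P) where

    module Centre (q : Pt n) (Pq : P q) (qβ : T (q t == β)) where

      atβ : ∀ a → U a → ∀ c → T (δ t c ⇒ a c == q c)
      atβ a (_ , _ , e) = at (λ c → a c == q c) t
        (taut 3 (λ a q β → a == β ∷ q == β ∷ [] ⊢ a == q) (a t) (q t) β e qβ)

      -- The way from `q` to `z` crosses `t` at an end on I(q,a), which is `a` itself because `a` is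
      -- nearest.
      across : ∀ a → U a → Near q a → ∀ z → P z → T (z t ⊕ q t) → btw q z (flip t a) → z ≈ flip t a
      across a Ua near z Pz zt qza c = reductio _ λ h →
        crossing iso t q z Pq Pz (taut 2 (λ z q → z ⊕ q ∷ [] ⊢ q ⊕ z) (z t) (q t) zt)
          λ (m , Pm , Pm′ , mq , qmz) →
            let Um = Pm , Pm′ , taut 3 (λ m q β → m == q ∷ q == β ∷ [] ⊢ m == β) (m t) (q t) β mq qβ in
            taut 5 (λ q a z m δ → (δ ⇒ a == q) ∷ (δ ⇒ z ⊕ q) ∷ bt q z (a ⊕ δ) ∷ bt q m z ∷ m == a ∷
                not (z == (a ⊕ δ)) ∷ [] ⊢ false)
              (q c) (a c) (z c) (m c) (δ t c) (atβ a Ua c) (at (λ c → z c ⊕ q c) t zt c) (qza c) (qmz c)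
              (near m Um (λ c → taut 5
                (λ q a z m δ → (δ ⇒ a == q) ∷ (δ ⇒ m == q) ∷ bt q z (a ⊕ δ) ∷ bt q m z ∷ [] ⊢ bt q m a)
                (q c) (a c) (z c) (m c) (δ t c) (atβ a Ua c) (atβ m Um c) (qza c) (qmz c)) c)
              h

      -- By `across`, no step from `flip t a` in a direction other than `t` leads back towards `q`;
      -- so a step towards another end changes a bit in which `a` still agrees with `q`.
      up : ∀ a p → U a → Near q a → U p → ∀ c → T (a c ⊕ p c) →
        ¬ ¬ ∃ λ r → T (a r == q r) × T (p r ⊕ q r) × P (flip r (flip t a))
      up a p Ua near Up c a≠p K = iso (flip t a) (flip t p) (proj₁ (proj₂ Ua)) (proj₁ (proj₂ Up)) c
        (taut 3 (λ a p δ → a ⊕ p ∷ [] ⊢ (a ⊕ δ) ⊕ (p ⊕ δ)) (a c) (p c) (δ t c) a≠p)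
        λ (r , ar , Pr) →
          let aq : T (a r == q r)
              aq = reductio _ λ h → taut 3 (λ a δ δ′ → δ′ ∷ ((a ⊕ δ) ⊕ δ′) == (a ⊕ δ) ∷ [] ⊢ false)
                (a r) (δ t r) (δ r r) (δ-refl r)
                (across a Ua near (flip r (flip t a)) Pr
                  (taut 4 (λ a q δ δ′ → δ ∷ a == q ∷ (δ′ ⇒ not (a == q)) ∷ [] ⊢ ((a ⊕ δ) ⊕ δ′) ⊕ q)
                    (a t) (q t) (δ t t) (δ r t) (δ-refl t)
                    (taut 2 (λ δ e → δ ∷ (δ ⇒ e) ∷ [] ⊢ e) (δ t t) (a t == q t) (δ-refl t) (atβ a Ua t))
                    (at (λ c → not (a c == q c)) r h t))
                  (λ c → taut 4 (λ a q δ δ′ → (δ ⇒ a == q) ∷ (δ′ ⇒ not (a == q)) ∷ [] ⊢ bt q ((a ⊕ δ) ⊕ δ′) (a ⊕ δ))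
                    (a c) (q c) (δ t c) (δ r c) (atβ a Ua c) (at (λ c → not (a c == q c)) r h c))
                  r)
          in K (r , aq ,
            taut 4 (λ a p q δ → a == q ∷ (a ⊕ δ) ⊕ (p ⊕ δ) ∷ [] ⊢ p ⊕ q) (a r) (p r) (q r) (δ t r) aq ar , Pr)

      module _ (a b : Pt n) (Ua : U a) (Ub : U b) (aqb : btw a q b) where

        -- Join-hull commutativity across `t`: `q` is in the box of `m`, `flip t a` and `flip t b`,
        -- and the way from `q` on to the resulting point crosses `t` at an end.
        partner : ∀ m → U m → ¬ ¬ ∃ λ s → U s × btw m q s × btw a s b × Near q s
        partner m Um K = jh m (flip t a) (flip t b) q (proj₁ Um) (proj₁ (proj₂ Ua)) (proj₁ (proj₂ Ub)) Pq
          (λ c → taut 5 (λ m a b q δ → (δ ⇒ m == q) ∷ (δ ⇒ a == q) ∷ bt a q b ∷ [] ⊢ bx m (a ⊕ δ) (b ⊕ δ) q)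
            (m c) (a c) (b c) (q c) (δ t c) (atβ m Um c) (atβ a Ua c) (aqb c))
          λ (z , Pz , azb , mqz) → crossing iso t q z Pq Pz
            (taut 5 (λ a b z q δ → δ ∷ (δ ⇒ a == q) ∷ (δ ⇒ b == q) ∷ bt (a ⊕ δ) z (b ⊕ δ) ∷ [] ⊢ q ⊕ z)
              (a t) (b t) (z t) (q t) (δ t t) (δ-refl t) (atβ a Ua t) (atβ b Ub t) (azb t))
            λ (m′ , Pm , Pm′ , mq , qmz) → nearest q m′
              (Pm , Pm′ , taut 3 (λ m q β → m == q ∷ q == β ∷ [] ⊢ m == β) (m′ t) (q t) β mq qβ)
              λ (s , Us , qsm , near) → K (s , Us ,
                (λ c → taut 5 (λ m q z m′ s → bt m q z ∷ bt q m′ z ∷ bt q s m′ ∷ [] ⊢ bt m q s)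
                  (m c) (q c) (z c) (m′ c) (s c) (mqz c) (qmz c) (qsm c)) ,
                (λ c → taut 7 (λ a b q z m′ s δ → (δ ⇒ a == q) ∷ (δ ⇒ s == q) ∷ bt (a ⊕ δ) z (b ⊕ δ) ∷ bt a q b ∷
                    bt q m′ z ∷ bt q s m′ ∷ [] ⊢ bt a s b)
                  (a c) (b c) (q c) (z c) (m′ c) (s c) (δ t c) (atβ a Ua c) (atβ s Us c)
                  (azb c) (aqb c) (qmz c) (qsm c)) ,
                near)

        -- Join-hull commutativity with apex `a` gives a point between `flip t m` and `flip t m′`,
        -- which `across` identifies as `flip t b`.
        complement : Near q b → ∀ m m′ → U m → U m′ → btw a m b → btw a m′ b → btw m q m′ →
          ∀ c → T (b c ⊕ q c ⇒ m c ⊕ q c ∨ m′ c ⊕ q c)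
        complement near m m′ Um Um′ amb am′b mqm′ c = reductio _ λ h →
          jh a (flip t m) (flip t m′) q (proj₁ Ua) (proj₁ (proj₂ Um)) (proj₁ (proj₂ Um′)) Pq
            (λ c → taut 5 (λ a m m′ q δ → (δ ⇒ a == q) ∷ (δ ⇒ m == q) ∷ bt m q m′ ∷ [] ⊢ bx a (m ⊕ δ) (m′ ⊕ δ) q)
              (a c) (m c) (m′ c) (q c) (δ t c) (atβ a Ua c) (atβ m Um c) (mqm′ c))
            λ (z , Pz , mzm , aqz) →
              taut 6 (λ b q m m′ z δ → (δ ⇒ b == q) ∷ bt (m ⊕ δ) z (m′ ⊕ δ) ∷ z == (b ⊕ δ) ∷
                  not (b ⊕ q ⇒ m ⊕ q ∨ m′ ⊕ q) ∷ [] ⊢ false)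
                (b c) (q c) (m c) (m′ c) (z c) (δ t c) (atβ b Ub c) (mzm c)
                (across b Ub near z Pz
                  (taut 5 (λ m m′ z q δ → δ ∷ (δ ⇒ m == q) ∷ (δ ⇒ m′ == q) ∷ bt (m ⊕ δ) z (m′ ⊕ δ) ∷ [] ⊢ z ⊕ q)
                    (m t) (m′ t) (z t) (q t) (δ t t) (δ-refl t) (atβ m Um t) (atβ m′ Um′ t) (mzm t))
                  (λ c → taut 7 (λ a b q m m′ z δ → (δ ⇒ b == q) ∷ bt (m ⊕ δ) z (m′ ⊕ δ) ∷ bt a q z ∷
                      bt a m b ∷ bt a m′ b ∷ bt a q b ∷ [] ⊢ bt q z (b ⊕ δ))
                    (a c) (b c) (q c) (m c) (m′ c) (z c) (δ t c) (atβ b Ub c)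
                    (mzm c) (aqz c) (amb c) (am′b c) (aqb c))
                  c)
                h

        -- If `s` saw `a` through `q`, it would lie on I(q,b) and so equal the nearest end `b`,
        -- which `p` would then see. Thus partners of uncovered ends are uncovered.
        partner-bad : Near q b → ∀ p → ¬ btw p q b → ∀ s → U s → btw p q s → btw a s b → ¬ btw s q a
        partner-bad near p ¬pqb s Us pqs asb sqa = ¬pqb λ c →
          taut 4 (λ p q s b → bt p q s ∷ s == b ∷ [] ⊢ bt p q b) (p c) (q c) (s c) (b c) (pqs c)
            (near s Us (λ c → taut 4 (λ a b q s → bt a s b ∷ bt s q a ∷ bt a q b ∷ [] ⊢ bt q s b)
              (a c) (b c) (q c) (s c) (asb c) (sqa c) (aqb c)) c)

    Covered : Pt n → Pt n → Pt n → Set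
    Covered q a b = ∀ p → U p → ¬ btw p q a → ¬ btw p q b → ⊥

    -- The induction for the two-sided statement

    module Inductive (q a b : Pt n) (Pq : P q) (qβ : T (q t == β)) (Ua : U a) (Ub : U b) (aqb : btw a q b)
      (near-a : Near q a) (near-b : Near q b)
      (ih : ∀ q′ b′ → P q′ → T (q′ t == β) → U b′ → btw a q′ b′ → Near q′ a → Near q′ b′ →
        d a b′ + d q′ a < d a b + d q a → Covered q′ a b′) where

      open Centre q Pq qβ

      bqa : btw b q a
      bqa = btw-sym a q b aqb

      module Opposite (p s : Pt n) (Up : U p) (Us : U s) (near-p : Near q p) (near-s : Near q s)
        (apb : btw a p b) (asb : btw a s b) (pqs : btw p q s)
        (¬pqa : ¬ btw p q a) (¬pqb : ¬ btw p q b) (¬sqa : ¬ btw s q a) (¬sqb : ¬ btw s q b)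
        (i : Fin n) (qia : T (q i ⊕ a i)) (Pq′ : P (flip i q)) (pi : T (p i ⊕ q i)) where

        q′ : Pt n
        q′ = flip i q

        i≢t : i ≢ t
        i≢t refl = taut 3 (λ a q δ → δ ∷ (δ ⇒ a == q) ∷ q ⊕ a ∷ [] ⊢ false) (a t) (q t) (δ t t) (δ-refl t) (atβ a Ua t) qia

        q′β : T (q′ t == β)
        q′β = taut 3 (λ q δ β → not δ ∷ q == β ∷ [] ⊢ (q ⊕ δ) == β) (q t) (δ i t) β (δ-≢ i≢t) qβ

        δi : ∀ c → T (δ i c ⇒ q c ⊕ a c ∧ p c ⊕ q c)
        δi = at (λ c → q c ⊕ a c ∧ p c ⊕ q c) i (taut 2 (λ a b → a ∷ b ∷ [] ⊢ a ∧ b) (q i ⊕ a i) (p i ⊕ q i) qia pi)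

        covers-b : ∀ m m′ → U m → U m′ → btw a m b → btw a m′ b → btw m q m′ →
          ∀ c → T (b c ⊕ q c ⇒ m c ⊕ q c ∨ m′ c ⊕ q c)
        covers-b = complement a b Ua Ub aqb near-b

        covers-a : ∀ m m′ → U m → U m′ → btw a m b → btw a m′ b → btw m q m′ →
          ∀ c → T (a c ⊕ q c ⇒ m c ⊕ q c ∨ m′ c ⊕ q c)
        covers-a m m′ Um Um′ amb am′b =
          complement b a Ub Ua bqa near-a m m′ Um Um′ (btw-sym a m b amb) (btw-sym a m′ b am′b)

        module Moved (b′ : Pt n) (Ub′ : U b′) (q′b′b : btw q′ b′ b) (near-b′ : Near q′ b′) where

          covered : Covered q′ a b′
          covered = ih q′ b′ Pq′ q′β Ub′
            (λ c → taut 5 (λ a b q b′ δ → bt a q b ∷ bt (q ⊕ δ) b′ b ∷ (δ ⇒ q ⊕ a) ∷ [] ⊢ bt a (q ⊕ δ) b′)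
              (a c) (b c) (q c) (b′ c) (δ i c) (aqb c) (q′b′b c) (δia c))
            (λ s Us q′sa → near-a s Us λ c →
              taut 4 (λ a q s δ → bt (q ⊕ δ) s a ∷ (δ ⇒ q ⊕ a) ∷ [] ⊢ bt q s a)
                (a c) (q c) (s c) (δ i c) (q′sa c) (δia c))
            near-b′
            (+-mono-≤-<
              (count-mono (λ c → a c ⊕ b′ c) (λ c → a c ⊕ b c) λ c → taut 5
                (λ a b q b′ δ → bt a q b ∷ bt (q ⊕ δ) b′ b ∷ (δ ⇒ q ⊕ a) ∷ [] ⊢ a ⊕ b′ ⇒ a ⊕ b)
                (a c) (b c) (q c) (b′ c) (δ i c) (aqb c) (q′b′b c) (δia c))
              (closer q a i qia))
            where
            δia : ∀ c → T (δ i c ⇒ q c ⊕ a c)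
            δia = at (λ c → q c ⊕ a c) i qia

          -- Otherwise s would not be covered from q′.
          b′≈p : b′ ≈ p
          b′≈p c = reductio _ λ h → covered s Us
            (λ sqa → ¬sqa λ c → taut 5 (λ s q a p δ → bt p q s ∷ (δ ⇒ q ⊕ a ∧ p ⊕ q) ∷ bt s (q ⊕ δ) a ∷ [] ⊢ bt s q a)
              (s c) (q c) (a c) (p c) (δ i c) (pqs c) (δi c) (sqa c))
            (λ sqb → taut 1 (λ e → not e ∷ e ∷ [] ⊢ false) (b′ c == p c) h (near-p b′ Ub′ (λ c →
              taut 7 (λ a b q p s b′ δ → bt a q b ∷ (b ⊕ q ⇒ p ⊕ q ∨ s ⊕ q) ∷ bt a p b ∷ bt (q ⊕ δ) b′ b ∷
                  bt s (q ⊕ δ) b′ ∷ (δ ⇒ q ⊕ a ∧ p ⊕ q) ∷ [] ⊢ bt q b′ p)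
                (a c) (b c) (q c) (p c) (s c) (b′ c) (δ i c)
                (aqb c) (covers-b p s Up Us apb asb pqs c) (apb c) (q′b′b c) (sqb c) (δi c)) c))

          -- Being `b′`, the end `p` lies on I(q′,b); so the step `i` is all that it has in common
          -- with the way from `q` to `a`.
          only-i : ∀ c → T (a c ⊕ q c ⇒ p c ⊕ q c ⇒ δ i c)
          only-i c = taut 6 (λ a b q p b′ δ → b′ == p ∷ bt a q b ∷ bt (q ⊕ δ) b′ b ∷ [] ⊢ a ⊕ q ⇒ p ⊕ q ⇒ δ)
            (a c) (b c) (q c) (p c) (b′ c) (δ i c) (b′≈p c) (aqb c) (q′b′b c)

          -- The point that join-hull commutativity yields is `flip t b` by `across`, so `flip t p`
          -- lies between `z` and `flip t b`. Where `s` differs from `q`, `p` does not.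
          on-side : ∀ z → P z → T (z t == q t) → T (z i ⊕ q i) → ∀ c → T (b c ⊕ q c ⇒ s c ⊕ q c ⇒ z c == q c)
          on-side z Pz zt zi c = reductio _ λ h →
            jh z (flip t b) q (flip t p) Pz (proj₁ (proj₂ Ub)) Pq (proj₁ (proj₂ Up))
              (λ c → taut 7 (λ z a b q p δ δ′ → (δ ⇒ b == q) ∷ (δ ⇒ z == q) ∷ (δ ⇒ p == q) ∷ (δ′ ⇒ z ⊕ q) ∷
                  bt a p b ∷ (a ⊕ q ⇒ p ⊕ q ⇒ δ′) ∷ [] ⊢ bx z (b ⊕ δ) q (p ⊕ δ))
                (z c) (a c) (b c) (q c) (p c) (δ t c) (δ i c) (atβ b Ub c) (at (λ c → z c == q c) t zt c) (atβ p Up c)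
                (at (λ c → z c ⊕ q c) i zi c) (apb c) (only-i c))
              λ (ζ , Pζ , bζq , zpζ) →
                taut 7 (λ b q p s z ζ δ → (δ ⇒ b == q) ∷ ζ == (b ⊕ δ) ∷ bt z (p ⊕ δ) ζ ∷ bt p q s ∷
                    not (b ⊕ q ⇒ s ⊕ q ⇒ z == q) ∷ [] ⊢ false)
                  (b c) (q c) (p c) (s c) (z c) (ζ c) (δ t c) (atβ b Ub c)
                  (across b Ub near-b ζ Pζ
                    (taut 5 (λ z p q ζ δ → δ ∷ (δ ⇒ p == q) ∷ z == q ∷ bt z (p ⊕ δ) ζ ∷ [] ⊢ ζ ⊕ q)
                      (z t) (p t) (q t) (ζ t) (δ t t) (δ-refl t) (atβ p Up t) zt (zpζ t))
                    (btw-sym (flip t b) ζ q bζq) c)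
                  (zpζ c) (pqs c) h

          -- Each failure to see `a` or `b` through `q` supplies a direction: `c₁` and `c₂` lead
          -- from `flip t a` towards `p` and `s`, the step from `flip t b` towards `p` can only be
          -- `i`, and in `c₃` both `s` and `a` differ from `q`.
          absurd : ⊥
          absurd =
            counterexample (λ c → bt (p c) (q c) (b c)) ¬pqb λ (c , h) →
            up a p Ua near-a Up c (taut 4 (λ a b p q → bt a q b ∷ not (bt p q b) ∷ [] ⊢ a ⊕ p)
              (a c) (b c) (p c) (q c) (aqb c) h) λ (c₁ , ac₁ , pc₁ , Py₁) →
            counterexample (λ c → bt (s c) (q c) (b c)) ¬sqb λ (c , h) →
            up a s Ua near-a Us c (taut 4 (λ a b s q → bt a q b ∷ not (bt s q b) ∷ [] ⊢ a ⊕ s)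
              (a c) (b c) (s c) (q c) (aqb c) h) λ (c₂ , ac₂ , sc₂ , Py₂) →
            counterexample (λ c → bt (p c) (q c) (a c)) ¬pqa λ (c , h) →
            up b p Ub near-b Up c (taut 4 (λ a b p q → bt a q b ∷ not (bt p q a) ∷ [] ⊢ b ⊕ p)
              (a c) (b c) (p c) (q c) (aqb c) h) λ (r , br , pr , Pv) →
            counterexample (λ c → bt (s c) (q c) (a c)) ¬sqa λ (c₃ , h) →
            Config.impossible c₁ c₂ c₃ ac₁ pc₁ Py₁ ac₂ sc₂ Py₂
              (taut 3 (λ a q s → not (bt s q a) ∷ [] ⊢ s ⊕ q ∧ a ⊕ q) (a c₃) (q c₃) (s c₃) h)
              (subst (λ r → P (flip r (flip t b))) (sym (δ-≡ {s = i} {t = r}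
                (taut 5 (λ a b q p δ → b == q ∷ p ⊕ q ∷ bt a p b ∷ (a ⊕ q ⇒ p ⊕ q ⇒ δ) ∷ [] ⊢ δ)
                  (a r) (b r) (q r) (p r) (δ i r) br pr (apb r) (only-i r)))) Pv)
            where
            module Config (c₁ c₂ c₃ : Fin n) (ac₁ : T (a c₁ == q c₁)) (pc₁ : T (p c₁ ⊕ q c₁))
              (Pu : P (flip c₁ (flip t a))) (ac₂ : T (a c₂ == q c₂)) (sc₂ : T (s c₂ ⊕ q c₂))
              (Py : P (flip c₂ (flip t a))) (sc₃ : T (s c₃ ⊕ q c₃ ∧ a c₃ ⊕ q c₃))
              (Pv : P (flip i (flip t b))) where

              u v y : Pt n
              u = flip c₁ (flip t a)
              v = flip i (flip t b)
              y = flip c₂ (flip t a)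

              δ₁ : ∀ c → T (δ c₁ c ⇒ a c == q c ∧ p c ⊕ q c)
              δ₁ = at (λ c → a c == q c ∧ p c ⊕ q c) c₁
                (taut 2 (λ a b → a ∷ b ∷ [] ⊢ a ∧ b) (a c₁ == q c₁) (p c₁ ⊕ q c₁) ac₁ pc₁)

              δ₂ : ∀ c → T (δ c₂ c ⇒ a c == q c ∧ s c ⊕ q c)
              δ₂ = at (λ c → a c == q c ∧ s c ⊕ q c) c₂
                (taut 2 (λ a b → a ∷ b ∷ [] ⊢ a ∧ b) (a c₂ == q c₂) (s c₂ ⊕ q c₂) ac₂ sc₂)

              box : Box u v q′ y
              box c = taut 9 (λ a b q p s δ δ′ δ₁ δ₂ → bt a q b ∷ bt p q s ∷ bt a s b ∷ bt a p b ∷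
                  (δ ⇒ a == q) ∷ (δ ⇒ b == q) ∷ (δ′ ⇒ q ⊕ a ∧ p ⊕ q) ∷
                  (δ₁ ⇒ a == q ∧ p ⊕ q) ∷ (δ₂ ⇒ a == q ∧ s ⊕ q) ∷ [] ⊢
                  bx ((a ⊕ δ) ⊕ δ₁) ((b ⊕ δ) ⊕ δ′) (q ⊕ δ′) ((a ⊕ δ) ⊕ δ₂))
                (a c) (b c) (q c) (p c) (s c) (δ t c) (δ i c) (δ c₁ c) (δ c₂ c)
                (aqb c) (pqs c) (asb c) (apb c) (atβ a Ua c) (atβ b Ub c) (δi c) (δ₁ c) (δ₂ c)

              module Apex (z : Pt n) (Pz : P z) (vzq′ : btw v z q′) (uyz : btw u y z) where

                zi : T (z i ⊕ q i)
                zi = taut 6 (λ a b q p z δ → δ ∷ (δ ⇒ q ⊕ a ∧ p ⊕ q) ∷ bt a q b ∷ bt (b ⊕ δ) z (q ⊕ δ) ∷ [] ⊢ z ⊕ q)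
                  (a i) (b i) (q i) (p i) (z i) (δ i i) (δ-refl i) (δi i) (aqb i)
                  (taut 5 (λ b q z δ δ′ → not δ ∷ bt ((b ⊕ δ) ⊕ δ′) z (q ⊕ δ′) ∷ [] ⊢ bt (b ⊕ δ′) z (q ⊕ δ′))
                    (b i) (q i) (z i) (δ t i) (δ i i) (δ-≢ (λ e → i≢t (sym e))) (vzq′ i))

                zc₁ : T (z c₁ == q c₁)
                zc₁ = taut 8 (λ a q p s z δ δ₁ δ₂ → δ₁ ∷ (δ ⇒ p == q) ∷ (δ₂ ⇒ a == q ∧ s ⊕ q) ∷ bt p q s ∷
                    p ⊕ q ∷ a == q ∷ bt ((a ⊕ δ) ⊕ δ₁) ((a ⊕ δ) ⊕ δ₂) z ∷ [] ⊢ z == q)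
                  (a c₁) (q c₁) (p c₁) (s c₁) (z c₁) (δ t c₁) (δ c₁ c₁) (δ c₂ c₁)
                  (δ-refl c₁) (atβ p Up c₁) (δ₂ c₁) (pqs c₁) pc₁ ac₁ (uyz c₁)

                zc₂ : T (z c₂ ⊕ q c₂)
                zc₂ = taut 8 (λ a q p s z δ δ₁ δ₂ → δ₂ ∷ (δ ⇒ s == q) ∷ (δ₁ ⇒ a == q ∧ p ⊕ q) ∷ bt p q s ∷
                    s ⊕ q ∷ a == q ∷ bt ((a ⊕ δ) ⊕ δ₁) ((a ⊕ δ) ⊕ δ₂) z ∷ [] ⊢ z ⊕ q)
                  (a c₂) (q c₂) (p c₂) (s c₂) (z c₂) (δ t c₂) (δ c₁ c₂) (δ c₂ c₂)
                  (δ-refl c₂) (atβ s Us c₂) (δ₁ c₂) (pqs c₂) sc₂ ac₂ (uyz c₂)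

                -- The end `m` crossed on the way from `q′` to `z` has a partner `m′` through `q`,
                -- and by induction `m′` sees `a` or `b′` through `q′`. The first fails at `c₃` and
                -- the second at `c₁`: there `z`, and so `m`, agrees with `q`.
                beyond : T (z t ⊕ q t) → ⊥
                beyond zt = crossing iso t q′ z Pq′ Pz
                  (taut 3 (λ q z δ → not δ ∷ z ⊕ q ∷ [] ⊢ (q ⊕ δ) ⊕ z) (q t) (z t) (δ i t) (δ-≢ i≢t) zt)
                  λ (m , Pm , Pm′ , mq , q′mz) →
                    let Um : U m
                        Um = Pm , Pm′ , taut 3 (λ m q β → m == q ∷ q == β ∷ [] ⊢ m == β) (m t) (q′ t) β mq q′β
                        amb : btw a m b
                        amb c = taut 8 (λ a b q p z m δ δ′ → bt a q b ∷ (δ ⇒ a == q) ∷ (δ ⇒ m == q) ∷ (δ′ ⇒ q ⊕ a ∧ p ⊕ q) ∷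
                            bt ((b ⊕ δ) ⊕ δ′) z (q ⊕ δ′) ∷ bt (q ⊕ δ′) m z ∷ [] ⊢ bt a m b)
                          (a c) (b c) (q c) (p c) (z c) (m c) (δ t c) (δ i c)
                          (aqb c) (atβ a Ua c) (atβ m Um c) (δi c) (vzq′ c) (q′mz c)
                    in partner a b Ua Ub aqb m Um λ (m′ , Um′ , mqm′ , am′b , _) → covered m′ Um′
                      (λ m′q′a → taut 9 (λ a b q p s z m m′ δ →
                          (δ ⇒ q ⊕ a ∧ p ⊕ q) ∷ bt p q s ∷ bt a q b ∷ s ⊕ q ∧ a ⊕ q ∷
                          bt (b ⊕ δ) z (q ⊕ δ) ∷ bt (q ⊕ δ) m z ∷ (a ⊕ q ⇒ m ⊕ q ∨ m′ ⊕ q) ∷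
                          bt m′ (q ⊕ δ) a ∷ [] ⊢ false)
                        (a c₃) (b c₃) (q c₃) (p c₃) (s c₃) (z c₃) (m c₃) (m′ c₃) (δ i c₃)
                        (δi c₃) (pqs c₃) (aqb c₃) sc₃
                        (taut 6 (λ a b q z δ δ′ → (δ ⇒ a == q) ∷ a ⊕ q ∷ bt ((b ⊕ δ) ⊕ δ′) z (q ⊕ δ′) ∷ [] ⊢ bt (b ⊕ δ′) z (q ⊕ δ′))
                          (a c₃) (b c₃) (q c₃) (z c₃) (δ t c₃) (δ i c₃) (atβ a Ua c₃)
                          (taut 2 (λ p q → p ∧ q ∷ [] ⊢ q) (s c₃ ⊕ q c₃) (a c₃ ⊕ q c₃) sc₃) (vzq′ c₃))
                        (q′mz c₃) (covers-a m m′ Um Um′ amb am′b mqm′ c₃) (m′q′a c₃))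
                      (λ m′q′b′ → taut 9 (λ a b q p b′ z m m′ δ →
                          (δ ⇒ q ⊕ a ∧ p ⊕ q) ∷ a == q ∷ p ⊕ q ∷ b′ == p ∷ bt a p b ∷ z == q ∷
                          bt (q ⊕ δ) m z ∷ (b ⊕ q ⇒ m ⊕ q ∨ m′ ⊕ q) ∷ bt m′ (q ⊕ δ) b′ ∷ [] ⊢ false)
                        (a c₁) (b c₁) (q c₁) (p c₁) (b′ c₁) (z c₁) (m c₁) (m′ c₁) (δ i c₁)
                        (δi c₁) ac₁ pc₁ (b′≈p c₁) (apb c₁) zc₁ (q′mz c₁)
                        (covers-b m m′ Um Um′ amb am′b mqm′ c₁) (m′q′b′ c₁))

                apex-impossible : ⊥
                apex-impossible = [ (λ zt → taut 5 (λ a b q s z → bt a s b ∷ a == q ∷ s ⊕ q ∷ z ⊕ q ∷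
                      (b ⊕ q ⇒ s ⊕ q ⇒ z == q) ∷ [] ⊢ false)
                    (a c₂) (b c₂) (q c₂) (s c₂) (z c₂) (asb c₂) ac₂ sc₂ zc₂ (on-side z Pz zt zi c₂))
                  , (λ zt → beyond (taut 2 (λ z q → not (z == q) ∷ [] ⊢ z ⊕ q) (z t) (q t) zt)) ]′ (decide (z t == q t))

              impossible : ⊥
              impossible = jh u v q′ y Pu Pv Pq′ Py box λ (z , Pz , vzq′ , uyz) → Apex.apex-impossible z Pz vzq′ uyz

        absurd : ⊥
        absurd = nearest q′ b Ub λ (b′ , Ub′ , q′b′b , near-b′) → Moved.absurd b′ Ub′ q′b′b near-b′

      -- An uncovered `p₀` is replaced by its partner `s` and the partner `p` of `s`: both are
      -- uncovered nearest ends on I(a,b), with `q` between them. A step `i` from `q` towards `a`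
      -- also approaches one of the two, by `complement`, and their roles are symmetric.
      covered : Covered q a b
      covered p₀ Up₀ ¬pqa ¬pqb =
        partner a b Ua Ub aqb p₀ Up₀ λ (s , Us , p₀qs , asb , near-s) →
        partner a b Ua Ub aqb s Us λ (p , Up , sqp , apb , near-p) →
        let ¬sqa : ¬ btw s q a
            ¬sqa = partner-bad a b Ua Ub aqb near-b p₀ ¬pqb s Us p₀qs asb
            ¬sqb : ¬ btw s q b
            ¬sqb = partner-bad b a Ub Ua bqa near-a p₀ ¬pqa s Us p₀qs (btw-sym a s b asb)
            ¬pqa′ : ¬ btw p q a
            ¬pqa′ = partner-bad a b Ua Ub aqb near-b s ¬sqb p Up sqp apb
            ¬pqb′ : ¬ btw p q b
            ¬pqb′ = partner-bad b a Ub Ua bqa near-a s ¬sqa p Up sqp (btw-sym a p b apb)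
        in counterexample (λ c → bt (s c) (q c) (a c)) ¬sqa λ (c , h) →
        iso q a Pq (proj₁ Ua) c (taut 3 (λ s q a → not (bt s q a) ∷ [] ⊢ q ⊕ a) (s c) (q c) (a c) h)
          λ (i , qia , Pq′) →
            [ Opposite.absurd p s Up Us near-p near-s apb asb (btw-sym s q p sqp) ¬pqa′ ¬pqb′ ¬sqa ¬sqb i qia Pq′
            , (λ pi → Opposite.absurd s p Us Up near-s near-p asb apb sqp ¬sqa ¬sqb ¬pqa′ ¬pqb′ i qia Pq′
                (taut 4 (λ p s q a → not (p ⊕ q) ∷ q ⊕ a ∷ (a ⊕ q ⇒ s ⊕ q ∨ p ⊕ q) ∷ [] ⊢ s ⊕ q)
                  (p i) (s i) (q i) (a i) pi qia
                  (complement b a Ub Ua bqa near-a s p Us Up (btw-sym a s b asb) (btw-sym a p b apb) sqp i)))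
            ]′ (decide (p i ⊕ q i))

    -- The end `a` is fixed throughout: `q` moves towards it, and the new `b` is no farther from it
    -- than the old one.
    two-sided : ∀ q a b → P q → T (q t == β) → U a → U b → btw a q b → Near q a → Near q b → Covered q a b
    two-sided q a b Pq qβ Ua Ub aqb near-a near-b = go q b Pq qβ Ub aqb near-a near-b (<-wellFounded (d a b + d q a))
      where
      go : ∀ q b → P q → T (q t == β) → U b → btw a q b → Near q a → Near q b →
        Acc _<_ (d a b + d q a) → Covered q a b
      go q b Pq qβ Ub aqb near-a near-b (acc rs) = Inductive.covered q a b Pq qβ Ua Ub aqb near-a near-b
        λ q′ b′ Pq′ q′β Ub′ aq′b′ near-a′ near-b′ l → go q′ b′ Pq′ q′β Ub′ aq′b′ near-a′ near-b′ (rs l)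

-- Inheritance by retracts

module _ {n : ℕ} {Q : Pt n → Set} (iso : Isometric Q) (C : Pt n → Set) (C⊆Q : ∀ x → C x → Q x)
  (convex : ∀ x y z → C x → C y → Q z → btw x z y → ¬ ¬ C z) where

  -- A convex set is the intersection of the half-spaces containing it.
  convex-reaches : ∀ k → C k → ∀ q → Q q → Hull C q → ¬ ¬ ∃ λ r → C r × r ≈ q
  convex-reaches k Ck q Qq hull = go k Ck (<-wellFounded (d k q))
    where
    go : ∀ k → C k → Acc _<_ (d k q) → ¬ ¬ ∃ λ r → C r × r ≈ q
    go k Ck (acc rs) K = counterexample (λ c → k c == q c) (λ h → K (k , Ck , h)) λ (c , h) →
      iso k q (C⊆Q k Ck) Qq c (taut 2 (λ k q → not (k == q) ∷ [] ⊢ k ⊕ q) (k c) (q c) h) λ (r , kr , Qr) →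
      excluded-middle (C (flip r k)) λ
        { (inj₁ Cr) → go (flip r k) Cr (rs (closer k q r kr)) K
        ; (inj₂ ¬Cr) → hull r λ k′ Ck′ → reductio _ λ h →
            convex k k′ (flip r k) Ck Ck′ Qr
              (flip-between k k′ r (taut 3 (λ k k′ q → k ⊕ q ∷ not (k′ ⊕ q) ∷ [] ⊢ k ⊕ k′) (k r) (k′ r) (q r) kr h))
              ¬Cr }

module _ {n : ℕ} (P Q : Pt n → Set) where

  -- What survives of a retraction of P onto Q, the image of s being s′.
  Retractable : Set
  Retractable = ∀ t β a b q s → Ends Q t β a → Ends Q t β b → Q q → btw a q b →
    Ends P t β s → btw q s b → ¬ ¬ ∃ λ s′ → Ends Q t β s′ × btw q s′ b × (s′ ≈ b → s ≈ b)

module _ {n : ℕ} {P Q : Pt n → Set} (Q⊆P : ∀ x → Q x → P x) (isoP : Isometric P) (isoQ : Isometric Q)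
  (jh : JoinHull P) (ph : PreHull P) (ret : Retractable P Q) where

  module _ (t : Fin n) (β : Bool) where

    private
      UP UQ : Pt n → Set
      UP = Ends P t β
      UQ = Ends Q t β

    UQ⊆UP : ∀ s → UQ s → UP s
    UQ⊆UP s (Qs , Qs′ , e) = Q⊆P s Qs , Q⊆P (flip t s) Qs′ , e

    -- An end on I(q,a) is sent to an end of the retract on I(q,a), hence to `a`; by the last clause
    -- of `Retractable` it was `a` already.
    near-lift : ∀ q a b → Q q → UQ a → UQ b → btw b q a → Near isoQ t β q a → Near isoP t β q a
    near-lift q a b Qq Ua Ub bqa near s Us qsa c = reductio _ λ h →
      ret t β b a q s Ub Ua Qq bqa Us qsa λ (s′ , Us′ , qs′a , back) →
        taut 1 (λ e → e ∷ not e ∷ [] ⊢ false) (s c == a c) (back (near s′ Us′ qs′a) c) h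

    record Span (q : Pt n) : Set where
      field
        a b : Pt n
        Ua : UQ a
        Ub : UQ b
        aqb : btw a q b
        near-a : Near isoQ t β q a
        near-b : Near isoQ t β q b

    Joined : Pt n → Set
    Joined q = Q q × ∃ λ a → ∃ λ b → UQ a × UQ b × btw a q b

    span : ∀ q → Joined q → ¬ ¬ Span q
    span q (Qq , a , b , Ua , Ub , aqb) K =
      nearest isoQ t β q a Ua λ (a′ , Ua′ , qaa , near-a) →
      nearest isoQ t β q b Ub λ (b′ , Ub′ , qbb , near-b) →
      K record { a = a′ ; b = b′ ; Ua = Ua′ ; Ub = Ub′ ; near-a = near-a ; near-b = near-b
        ; aqb = λ c → taut 5 (λ a q b a′ b′ → bt a q b ∷ bt q a′ a ∷ bt q b′ b ∷ [] ⊢ bt a′ q b′)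
            (a c) (q c) (b c) (a′ c) (b′ c) (aqb c) (qaa c) (qbb c) }

    split : ∀ q → Q q → (S : Span q) → ∀ p → UP p → ¬ ¬ (btw p q (Span.a S) ⊎ btw p q (Span.b S))
    split q Qq S p Up K = two-sided isoP t β jh q S.a S.b (Q⊆P q Qq)
      (taut 4 (λ a q b β → a == β ∷ b == β ∷ bt a q b ∷ [] ⊢ q == β) (S.a t) (q t) (S.b t) β
        (proj₂ (proj₂ S.Ua)) (proj₂ (proj₂ S.Ub)) (S.aqb t))
      (UQ⊆UP S.a S.Ua) (UQ⊆UP S.b S.Ub) S.aqb
      (near-lift q S.a S.b Qq S.Ua S.Ub (btw-sym S.a q S.b S.aqb) S.near-a)
      (near-lift q S.b S.a Qq S.Ub S.Ua S.aqb S.near-b)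
      p Up (λ h → K (inj₁ h)) (λ h → K (inj₂ h))
      where module S = Span S

    split-either : ∀ q → Q q → (S : Span q) → ∀ p → UP p → ¬ ¬ ∃ λ a → UQ a × btw p q a
    split-either q Qq S p Up K = split q Qq S p Up
      [ (λ h → K (Span.a S , Span.Ua S , h)) , (λ h → K (Span.b S , Span.Ub S , h)) ]′

    -- `split` is applied at `x` and `y` to the four ends in turn. Once two ends see each other
    -- through both `x` and `y`, all of I(x,y) lies between them; the one remaining combination is
    -- settled bit by bit.
    joined-convex : ∀ x y z → Joined x → Joined y → Q z → btw x z y → ¬ ¬ Joined z
    joined-convex x y z Jx Jy Qz xzy K = span x Jx λ S → span y Jy λ S′ → combine S S′
      where
      combine : Span x → Span y → ⊥
      combine S S′ = split x (proj₁ Jx) S S′.a (UQ⊆UP S′.a S′.Ua)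
        [ one S.a S.b S.Ua S.Ub S.aqb
            (split x (proj₁ Jx) S)
        , one S.b S.a S.Ub S.Ua (btw-sym S.a x S.b S.aqb)
            (λ p Up h → split x (proj₁ Jx) S p Up [ (λ k → h (inj₂ k)) , (λ k → h (inj₁ k)) ]′) ]′
        where
        module S = Span S
        module S′ = Span S′
        close : ∀ a c → UQ a → UQ c → btw c x a → btw a y c → ⊥
        close a c Ua Uc cxa ayc = K (Qz , a , c , Ua , Uc , λ i →
          taut 5 (λ a c x y z → bt c x a ∷ bt a y c ∷ bt x z y ∷ [] ⊢ bt a z c)
            (a i) (c i) (x i) (y i) (z i) (cxa i) (ayc i) (xzy i))
        one : ∀ a b → UQ a → UQ b → btw a x b → (∀ p → UP p → ¬ ¬ (btw p x a ⊎ btw p x b)) →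
          btw S′.a x a → ⊥
        one a b Ua Ub axb splits a′xa = split y (proj₁ Jy) S′ a (UQ⊆UP a Ua)
          [ close a S′.a Ua S′.Ua a′xa
          , (λ ayb′ → splits S′.b (UQ⊆UP S′.b S′.Ub)
              [ (λ b′xa → close a S′.b Ua S′.Ub b′xa ayb′)
              , (λ b′xb → split y (proj₁ Jy) S′ b (UQ⊆UP b Ub)
                  [ (λ bya′ → K (Qz , a , S′.a , Ua , S′.Ua , λ i →
                      taut 7 (λ a b a′ b′ x y z → bt a x b ∷ bt a′ x a ∷ bt b′ x b ∷ bt a′ y b′ ∷ bt a y b′ ∷
                          bt b y a′ ∷ bt x z y ∷ [] ⊢ bt a z a′)
                        (a i) (b i) (S′.a i) (S′.b i) (x i) (y i) (z i)
                        (axb i) (a′xa i) (b′xb i) (S′.aqb i) (ayb′ i) (bya′ i) (xzy i)))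
                  , (λ byb′ → close b S′.b Ub S′.Ub b′xb byb′) ]′) ]′) ]′

    hull-joined : ∀ q → Q q → Hull UQ q → ¬ ¬ Joined q
    -- The hull at a coordinate, here `t`, provides the end from which `convex-reaches` starts.
    hull-joined q Qq hull K = hull t λ s Us → ⊥-elim
      (convex-reaches isoQ Joined (λ x → proj₁) joined-convex s (joined s Us) q Qq
        (λ c sep → hull c λ s Us → sep s (joined s Us))
        λ (r , (Qr , a , b , Ua , Ub , arb) , r≈q) → K (Qq , a , b , Ua , Ub , λ c →
          taut 4 (λ a r b q → bt a r b ∷ r == q ∷ [] ⊢ bt a q b) (a c) (r c) (b c) (q c) (arb c) (r≈q c)))
      where
      joined : ∀ s → UQ s → Joined s
      joined s Us = proj₁ Us , s , s , Us , Us , btw-refl s s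

  -- The end `s` found in P is brought into Q in two moves: it sees an end `c` of Q through `p`, and
  -- `c` sees an end `a` of Q through `q`. With `q` between `p` and `s`, this puts `q` between `p`
  -- and `a`.
  retract-preHull : PreHull Q
  retract-preHull t β p q Qp Qq hull-p hull-q K =
    hull-joined t β p Qp hull-p λ Jp → span t β p Jp λ Sp →
    hull-joined t β q Qq hull-q λ Jq → span t β q Jq λ Sq →
    ph t β p q (Q⊆P p Qp) (Q⊆P q Qq) (lift hull-p) (lift hull-q) λ (s , Us , pqs) →
    split-either t β p Qp Sp s Us λ (c , Uc , spc) →
    split-either t β q Qq Sq c (UQ⊆UP t β c Uc) λ (a , Ua , cqa) →
    K (a , Ua , λ i → taut 5 (λ p q s c a → bt p q s ∷ bt s p c ∷ bt c q a ∷ [] ⊢ bt p q a)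
      (p i) (q i) (s i) (c i) (a i) (pqs i) (spc i) (cqa i))
    where
    lift : ∀ {x} → Hull (Ends Q t β) x → Hull (Ends P t β) x
    lift hull c sep = hull c λ s Us → sep s (UQ⊆UP t β s Us)

module _ {n : ℕ} {P Q : Pt n → Set} (resp : ∀ {x y} → x ≈ y → P x → P y) (respQ : ∀ {x y} → x ≈ y → Q x → Q y)
  (Q⊆P : ∀ x → Q x → P x)
  (isoP : Isometric P) (isoQ : Isometric Q) (hph : HereditaryPreHull P) (ret : Retractable P Q) where

  retract-joinHull : JoinHull Q
  retract-joinHull = hereditaryPreHull⇒joinHull respQ isoQ λ m o →
    retract-preHull (λ x (Qx , F) → Q⊆P x Qx , F) (Face-isometric isoP m o) (Face-isometric isoQ m o)
      (face-joinHull m o) (hph m o) (face-retractable m o)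
    where
    face-joinHull : ∀ m o → JoinHull (Face P m o)
    face-joinHull m o u v w y (Pu , Fu) (Pv , Fv) (Pw , Fw) (Py , Fy) box K =
      hereditaryPreHull⇒joinHull resp isoP hph u v w y Pu Pv Pw Py box λ (z , Pz , vzw , uyz) →
        K (z , (Pz , λ c → taut 5 (λ m o v w z → (m ⇒ v == o) ∷ (m ⇒ w == o) ∷ bt v z w ∷ [] ⊢ m ⇒ z == o)
          (m c) (o c) (v c) (w c) (z c) (Fv c) (Fw c) (vzw c)) , vzw , uyz)
    -- `s′` stays in the face because it lies between `q` and `b`; its flip does because `b` and
    -- `flip t b` are both in the face, which leaves `t` free.
    face-retractable : ∀ m o → Retractable (Face P m o) (Face Q m o)
    face-retractable m o t β a b q s ((Qa , Fa) , (Qa′ , Fa′) , ea) ((Qb , Fb) , (Qb′ , Fb′) , eb) (Qq , Fq) aqb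
      ((Ps , Fs) , (Ps′ , Fs′) , es) qsb K =
      ret t β a b q s (Qa , Qa′ , ea) (Qb , Qb′ , eb) Qq aqb (Ps , Ps′ , es) qsb
        λ (s′ , (Qs , Qs′ , e) , qs′b , back) →
          let Fs″ : ∀ c → T (m c ⇒ s′ c == o c)
              Fs″ c = taut 5 (λ m o q b s → (m ⇒ q == o) ∷ (m ⇒ b == o) ∷ bt q s b ∷ [] ⊢ m ⇒ s == o)
                (m c) (o c) (q c) (b c) (s′ c) (Fq c) (Fb c) (qs′b c)
          in K (s′ , ((Qs , Fs″) , (Qs′ , λ c →
            taut 5 (λ m o b s δ → (m ⇒ b == o) ∷ (m ⇒ (b ⊕ δ) == o) ∷ (m ⇒ s == o) ∷ [] ⊢ m ⇒ (s ⊕ δ) == o)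
              (m c) (o c) (b c) (s′ c) (δ t c) (Fb c) (Fb′ c) (Fs″ c)) , e) , qs′b , back)

-- Graphs isometrically embedded in a hypercube

⊕⇒≢ : ∀ {a b} → T (a ⊕ b) → a ≢ b
⊕⇒≢ {true} () refl
⊕⇒≢ {false} () refl

≢⇒⊕ : ∀ {a b} → a ≢ b → T (a ⊕ b)
≢⇒⊕ {true} {true} h = ⊥-elim (h refl)
≢⇒⊕ {true} {false} h = tt
≢⇒⊕ {false} {true} h = tt
≢⇒⊕ {false} {false} h = ⊥-elim (h refl)

unique-⊆-length : {A : Set} {xs ys : List A} → Unique xs → (∀ {j} → j ∈ xs → j ∈ ys) → length xs ≤ length ys
unique-⊆-length [] sub = z≤n
unique-⊆-length {xs = x ∷ xs} (x∉ ∷ u) sub with ∈-∃++ (sub (here refl))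
... | l , r , refl = ≤-trans (s≤s (unique-⊆-length u sub′)) (≤-reflexive (sym (↭-length (shift x l r))))
  where
  sub′ : ∀ {j} → j ∈ xs → j ∈ l ++ r
  sub′ j∈ with ∈-++⁻ l (sub (there j∈))
  ... | inj₁ p = ∈-++⁺ˡ p
  ... | inj₂ (here refl) = ⊥-elim (All.lookup x∉ j∈ refl)
  ... | inj₂ (there p) = ∈-++⁺ʳ l p

module _ {I : Set} where

  module _ {f g : I → Bool} where

    hamming-∈ : ∀ {n} (h : HammingDist f g n) → ∀ i → T (f i ⊕ g i) → i ∈ proj₁ h
    hamming-∈ (_ , _ , _ , c) i p = proj₁ (c i) (⊕⇒≢ p)

    hamming-⊕ : ∀ {n} (h : HammingDist f g n) → ∀ i → i ∈ proj₁ h → T (f i ⊕ g i)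
    hamming-⊕ (_ , _ , _ , c) i p = ≢⇒⊕ (proj₂ (c i) p)

    hamming : (xs : List I) → Unique xs → (∀ i → T (f i ⊕ g i) → i ∈ xs) → (∀ i → i ∈ xs → T (f i ⊕ g i)) →
      HammingDist f g (length xs)
    hamming xs u to from = xs , refl , u , λ i → (λ p → to i (≢⇒⊕ p)) , λ p → ⊕⇒≢ (from i p)

  hamming-refl : ∀ {f g : I → Bool} → (∀ i → T (f i == g i)) → HammingDist f g 0
  hamming-refl {f} {g} h = hamming [] [] (λ i p → ⊥-elim (taut 2 (λ f g → f == g ∷ f ⊕ g ∷ [] ⊢ false) (f i) (g i) (h i) p)) λ i ()

  hamming-flip : ∀ {f g : I → Bool} j → T (f j ⊕ g j) → (∀ i → T (f i ⊕ g i) → i ≡ j) → HammingDist f g 1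
  hamming-flip j p h = hamming (j ∷ []) ([] ∷ []) (λ i q → here (h i q)) λ { i (here refl) → p }

  hamming-1 : ∀ {f g : I → Bool} → HammingDist f g 1 → ∃ λ j → T (f j ⊕ g j) × (∀ i → T (f i ⊕ g i) → i ≡ j)
  hamming-1 h@(j ∷ [] , refl , _ , _) = j , hamming-⊕ h j (here refl) , λ i p → single (hamming-∈ h i p)
    where
    single : ∀ {i} → i ∈ j ∷ [] → i ≡ j
    single (here e) = e

  Between : (I → Bool) → (I → Bool) → (I → Bool) → Set
  Between f g h = ∀ i → T (bt (f i) (g i) (h i))

  between-+ : ∀ {f g h : I → Bool} {a b} → Between f g h → HammingDist f g a → HammingDist g h b → HammingDist f h (a + b)
  between-+ {f} {g} {h} bet F@(xs , refl , u , _) G@(ys , refl , v , _) =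
    subst (HammingDist f h) (length-++ xs) (hamming (xs ++ ys)
      (Unique.++⁺ u v λ { {i} (p , q) → taut 3 (λ f g h → bt f g h ∷ f ⊕ g ∷ g ⊕ h ∷ [] ⊢ false)
        (f i) (g i) (h i) (bet i) (hamming-⊕ F i p) (hamming-⊕ G i q) })
      (λ i p → [ (λ q → ∈-++⁺ˡ (hamming-∈ F i q)) , (λ q → ∈-++⁺ʳ xs (hamming-∈ G i
          (taut 3 (λ f g h → f ⊕ h ∷ not (f ⊕ g) ∷ [] ⊢ g ⊕ h) (f i) (g i) (h i) p q))) ]′ (decide (f i ⊕ g i)))
      (λ i p → [ (λ q → taut 3 (λ f g h → bt f g h ∷ f ⊕ g ∷ [] ⊢ f ⊕ h) (f i) (g i) (h i) (bet i) (hamming-⊕ F i q))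
        , (λ q → taut 3 (λ f g h → bt f g h ∷ g ⊕ h ∷ [] ⊢ f ⊕ h) (f i) (g i) (h i) (bet i) (hamming-⊕ G i q))
        ]′ (∈-++⁻ xs p)))

  -- A direction violating betweenness is counted in both summands and not in the total, which is
  -- then too small to be their sum.
  +-between : ∀ {f g h : I → Bool} {a b} → HammingDist f g a → HammingDist g h b → HammingDist f h (a + b) → Between f g h
  +-between {f} {g} {h} F@(xs , refl , _ , _) G@(ys , refl , _ , _) H@(zs , e , w , _) i = reductio _ λ p →
    excess (hamming-∈ F i (taut 3 (λ f g h → not (bt f g h) ∷ [] ⊢ f ⊕ g) (f i) (g i) (h i) p))
      (∈-∃++ (hamming-∈ G i (taut 3 (λ f g h → not (bt f g h) ∷ [] ⊢ g ⊕ h) (f i) (g i) (h i) p)))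
      (λ q → taut 3 (λ f g h → not (bt f g h) ∷ f ⊕ h ∷ [] ⊢ false) (f i) (g i) (h i) p (hamming-⊕ H i q))
    where
    excess : i ∈ xs → (∃ λ l → ∃ λ r → ys ≡ l ++ [ i ] ++ r) → ¬ i ∈ zs → ⊥
    excess i∈xs (l , r , ys≡) i∉zs = 1+n≰n (begin
      suc (length xs + length ys)       ≡⟨ cong suc e ⟨
      length (i ∷ zs)                   ≤⟨ unique-⊆-length (All.tabulate (λ { j∈ refl → i∉zs j∈ }) ∷ w) sub ⟩
      length (xs ++ l ++ r)             ≡⟨ length-++ xs ⟩
      length xs + length (l ++ r)       ≤⟨ +-monoʳ-≤ (length xs) (n≤1+n _) ⟩
      length xs + length (i ∷ l ++ r)   ≡⟨ cong (length xs +_) (trans (cong length ys≡) (↭-length (shift i l r))) ⟨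
      length xs + length ys             ∎)
      where
      open ≤-Reasoning
      sub : ∀ {j} → j ∈ i ∷ zs → j ∈ xs ++ (l ++ r)
      sub (here refl) = ∈-++⁺ˡ i∈xs
      sub {j} (there j∈) with decide (f j ⊕ g j)
      ... | inj₁ p = ∈-++⁺ˡ (hamming-∈ F j p)
      ... | inj₂ p with ∈-++⁻ l (subst (j ∈_) ys≡ (hamming-∈ G j
                 (taut 3 (λ f g h → f ⊕ h ∷ not (f ⊕ g) ∷ [] ⊢ g ⊕ h) (f j) (g j) (h j) (hamming-⊕ H j j∈) p)))
      ...   | inj₁ q = ∈-++⁺ʳ xs (∈-++⁺ˡ q)
      ...   | inj₂ (here refl) = ⊥-elim (i∉zs j∈)
      ...   | inj₂ (there q) = ∈-++⁺ʳ xs (∈-++⁺ʳ l q)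

module _ {G : Graph} where

  dist-unique : ∀ {x y m n} → Dist G x y m → Dist G x y n → m ≡ n
  dist-unique (v , p) (w , q) = ≤-antisym (p _ w) (q _ v)

  dist-refl : ∀ x → Dist G x x 0
  dist-refl x = stay , λ _ _ → z≤n

  dist-0 : ∀ {x y} → Dist G x y 0 → x ≡ y
  dist-0 (stay , _) = refl

  _⊙_ : ∀ {x y z m n} → Walk G x y m → Walk G y z n → Walk G x z (m + n)
  stay ⊙ w = w
  along e v ⊙ w = along e (v ⊙ w)

  dist-edge : ∀ {x y} → E G x y → Dist G x y 1
  dist-edge e = along e stay , λ { zero stay → ⊥-elim (irrfl G e) ; (suc m) _ → s≤s z≤n }

  dist-tail : ∀ {x y z n} (e : E G x y) (w : Walk G y z n) → (∀ m → Walk G x z m → suc n ≤ m) → Dist G y z n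
  dist-tail e w min = w , λ m v → s≤s⁻¹ (min (suc m) (along e v))

record Embedding (G : Graph) {I : Set} (φ : V G → I → Bool) : Set where
  field
    connected : Connected G
    to : ∀ {x y n} → Dist G x y n → HammingDist (φ x) (φ y) n
    from : ∀ {x y n} → HammingDist (φ x) (φ y) n → Dist G x y n

  edge-direction : ∀ {x y} → E G x y → ∃ λ j → T (φ x j ⊕ φ y j) × (∀ i → T (φ x i ⊕ φ y i) → i ≡ j)
  edge-direction e = hamming-1 (to (dist-edge e))

  -- Distances are to be computed, without deciding equality on `I`. Each edge changes one bit, so
  -- the list of differing directions gains that direction or loses it, the latter through a filter
  -- that compares bits only.
  walk-hamming : ∀ {x y n} → Walk G x y n → ∃ λ m → HammingDist (φ x) (φ y) m
  walk-hamming {x} stay = 0 , hamming-refl λ i → ==-refl (φ x i)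
  walk-hamming {x} {y} (along {y = z} e w) with edge-direction e | walk-hamming w
  ... | i , xzi , only | n , H@(ds , _ , u , _) with decide (φ z i ⊕ φ y i)
  ...   | inj₁ p = _ , hamming (filter (λ j → ¬? (φ x j Bool.≟ φ y j)) ds) (Unique.filter⁺ _ u)
            (λ j q → ∈-filter⁺ _ (hamming-∈ H j (reductio _ λ r → later j q r)) (⊕⇒≢ q))
            (λ j q → ≢⇒⊕ (proj₂ (∈-filter⁻ (λ j → ¬? (φ x j Bool.≟ φ y j)) {xs = ds} q)))
    where
    later : ∀ j → T (φ x j ⊕ φ y j) → T (not (φ z j ⊕ φ y j)) → ⊥
    later j q r with only j (taut 3 (λ x y z → x ⊕ y ∷ not (z ⊕ y) ∷ [] ⊢ x ⊕ z) (φ x j) (φ y j) (φ z j) q r)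
    ... | refl = taut 1 (λ a → a ∷ not a ∷ [] ⊢ false) (φ z j ⊕ φ y j) p r
  ...   | inj₂ p = _ , hamming (i ∷ ds)
            (All.tabulate (λ { j∈ refl → taut 1 (λ a → not a ∷ a ∷ [] ⊢ false) (φ z i ⊕ φ y i) p (hamming-⊕ H i j∈) }) ∷ u)
            (λ j q → [ (λ r → here (only j r))
              , (λ r → there (hamming-∈ H j (taut 3 (λ x y z → x ⊕ y ∷ not (x ⊕ z) ∷ [] ⊢ z ⊕ y) (φ x j) (φ y j) (φ z j) q r)))
              ]′ (decide (φ x j ⊕ φ z j)))
            (λ { j (here refl) → taut 3 (λ x y z → x ⊕ z ∷ not (z ⊕ y) ∷ [] ⊢ x ⊕ y) (φ x j) (φ y j) (φ z j) xzi p
               ; j (there q) → [ (λ r → back j q r)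
                 , (λ r → taut 3 (λ x y z → not (x ⊕ z) ∷ z ⊕ y ∷ [] ⊢ x ⊕ y) (φ x j) (φ y j) (φ z j) r (hamming-⊕ H j q))
                 ]′ (decide (φ x j ⊕ φ z j)) })
    where
    back : ∀ j → j ∈ ds → T (φ x j ⊕ φ z j) → T (φ x j ⊕ φ y j)
    back j q r with only j r
    ... | refl = ⊥-elim (taut 1 (λ a → not a ∷ a ∷ [] ⊢ false) (φ z i ⊕ φ y i) p (hamming-⊕ H i q))

  distance : ∀ x y → ∃ λ n → Dist G x y n
  distance x y with walk-hamming (proj₂ (connected x y))
  ... | n , h = n , from h

  interval⇒between : ∀ {x y z} → Interval G x y z → Between (φ x) (φ z) (φ y)
  interval⇒between (a , b , p , q , r) = +-between (to p) (to q) (to r)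

  between⇒dist : ∀ {x y z a b} → Between (φ x) (φ z) (φ y) → Dist G x z a → Dist G z y b → Dist G x y (a + b)
  between⇒dist bet p q = from (between-+ bet (to p) (to q))

  between⇒interval : ∀ {x y z} → Between (φ x) (φ z) (φ y) → Interval G x y z
  between⇒interval {x} {y} {z} bet = _ , _ , p , q , between⇒dist bet p q
    where
    p = proj₂ (distance x z)
    q = proj₂ (distance z y)

  ext : ∀ {x y} → (∀ i → T (φ x i == φ y i)) → x ≡ y
  ext h = dist-0 (from (hamming-refl h))

  -- `I` may be infinite, so three distances are compared instead of the bits.
  between? : ∀ x z y → Dec (Between (φ x) (φ z) (φ y))
  between? x z y with distance x z | distance z y | distance x y
  ... | a , p | b , q | n , r with a + b Nat.≟ n
  ...   | yes refl = yes (+-between (to p) (to q) (to r))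
  ...   | no a+b≢n = no λ bet → a+b≢n (dist-unique (between⇒dist bet p q) r)

module _ {G : Graph} {A : Subset (V G)} where

  induced-walk : ∀ {x y n} → Walk (Induced G A) x y n → Walk G (proj₁ x) (proj₁ y) n
  induced-walk stay = stay
  induced-walk (along e w) = along e (induced-walk w)

  module _ {I : Set} {φ : V G → I → Bool} (emb : Embedding G φ) where

    open Embedding emb

    isometric-embedding : (∀ x y n → Dist G (proj₁ x) (proj₁ y) n → Dist (Induced G A) x y n) →
      Embedding (Induced G A) (λ x → φ (proj₁ x))
    isometric-embedding lift = record
      { connected = λ x y → _ , proj₁ (lift x y _ (proj₂ (distance (proj₁ x) (proj₁ y))))
      ; to = λ {x} {y} p → let n , q = distance (proj₁ x) (proj₁ y) in
          subst (HammingDist _ _) (dist-unique (lift x y n q) p) (to q)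
      ; from = λ h → lift _ _ _ (from h)
      }

    convex-embedding : PropValued A → Convex G A → Embedding (Induced G A) (λ x → φ (proj₁ x))
    convex-embedding prop convex = isometric-embedding λ x y n p →
      lift n (proj₂ x) (proj₂ y) p , λ m w → proj₂ p m (induced-walk w)
      where
      lift : ∀ n {x y} (px : A x) (py : A y) → Dist G x y n → Walk (Induced G A) (x , px) (y , py) n
      -- The path arrives with a membership proof of its own, which has to be identified with the
      -- prescribed one.
      lift zero px py (stay , _) = subst (λ q → Walk (Induced G A) (_ , px) (_ , q) 0) (prop _ px py) stay
      lift (suc n) {x} {y} px py (along {y = z} e w , min) =
        along e (lift n (convex x y z px py (1 , n , dist-edge e , rest , along e w , min)) py rest)
        where
        rest : Dist G z y n
        rest = dist-tail e w min

    module _ (r : IsRetract G A) where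

      private
        f = proj₁ r

      retraction-≤ : ∀ {x y n} → Dist G x y n → ∃ λ m → Dist (Induced G A) (f x) (f y) m × m ≤ n
      retraction-≤ = proj₁ (proj₂ r) _ _ _

      fixes : ∀ x → f (proj₁ x) ≡ x
      fixes (x , px) = proj₂ (proj₂ r) x px

      retract-dist : ∀ x y n → Dist G (proj₁ x) (proj₁ y) n → Dist (Induced G A) x y n
      retract-dist x y n p with retraction-≤ p
      ... | m , q , m≤n = subst (Dist (Induced G A) x y) (≤-antisym m≤n (proj₂ p m (induced-walk (proj₁ q′)))) q′
        where
        q′ : Dist (Induced G A) x y m
        q′ = subst₂ (λ x y → Dist (Induced G A) x y m) (fixes x) (fixes y) q

      retract-embedding : Embedding (Induced G A) (λ x → φ (proj₁ x))
      retract-embedding = isometric-embedding retract-dist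

      -- Neither leg of the way from `x` through `g` to `y` can grow, and their sum cannot fall
      -- below the distance of `x` and `y`; so both lengths are kept.
      retraction-between : ∀ x y g → Between (φ (proj₁ x)) (φ g) (φ (proj₁ y)) →
        Between (φ (proj₁ x)) (φ (proj₁ (f g))) (φ (proj₁ y)) ×
        (∀ n → Dist G g (proj₁ y) n → Dist (Induced G A) (f g) y n)
      retraction-between x y g bet with distance (proj₁ x) g | distance g (proj₁ y)
      ... | a , p | b , q with retraction-≤ p | retraction-≤ q
      ...   | a′ , p′ , a′≤a | b′ , q′ , b′≤b =
        Embedding.interval⇒between retract-embedding {x} {y} {f g} (a , b , p‴ , q‴ , r″) ,
        λ n h → subst (Dist (Induced G A) (f g) y) (dist-unique q h) q‴
        where
        p″ : Dist (Induced G A) x (f g) a′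
        p″ = subst (λ x → Dist (Induced G A) x (f g) a′) (fixes x) p′
        q″ : Dist (Induced G A) (f g) y b′
        q″ = subst (λ y → Dist (Induced G A) (f g) y b′) (fixes y) q′
        r″ : Dist (Induced G A) x y (a + b)
        r″ = retract-dist x y _ (between⇒dist bet p q)
        total : a + b ≤ a′ + b′
        total = proj₂ r″ _ (proj₁ p″ ⊙ proj₁ q″)
        a≡a′ : a′ ≡ a
        a≡a′ = ≤-antisym a′≤a (+-cancelʳ-≤ b a a′ (≤-trans total (+-monoʳ-≤ a′ b′≤b)))
        b≡b′ : b′ ≡ b
        b≡b′ = ≤-antisym b′≤b (+-cancelˡ-≤ a b b′ (≤-trans total (+-monoˡ-≤ b′ a′≤a)))
        p‴ : Dist (Induced G A) x (f g) a
        p‴ = subst (Dist (Induced G A) x (f g)) a≡a′ p″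
        q‴ : Dist (Induced G A) (f g) y b
        q‴ = subst (Dist (Induced G A) (f g) y) b≡b′ q″

-- Finite boxes of a partial cube as sets of bit vectors

-- The double negation replaces decidable equality on I.
enumerate : {I : Set} (L : List I) → ¬ ¬ ∃ λ n → ∃ λ (cs : Fin n → I) →
  (∀ j k → cs j ≡ cs k → j ≡ k) × (∀ i → i ∈ L → ∃ λ k → cs k ≡ i)
enumerate [] K = K (0 , (λ ()) , (λ ()) , λ i ())
enumerate {I} (i ∷ L) K = enumerate L λ (n , cs , inj , cover) → excluded-middle (∃ λ k → cs k ≡ i) λ
  { (inj₁ (k , e)) → K (n , cs , inj , λ { j (here refl) → k , e ; j (there p) → cover j p })
  ; (inj₂ new) → K (suc n , cons i cs , cons-inj new inj ,
      λ { j (here refl) → zero , refl ; j (there p) → suc (proj₁ (cover j p)) , proj₂ (cover j p) }) }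
  where
  cons : ∀ {n} → I → (Fin n → I) → Fin (suc n) → I
  cons i cs zero = i
  cons i cs (suc k) = cs k
  cons-inj : ∀ {n} {cs : Fin n → I} → ¬ (∃ λ k → cs k ≡ i) → (∀ j k → cs j ≡ cs k → j ≡ k) →
    ∀ j k → cons i cs j ≡ cons i cs k → j ≡ k
  cons-inj new inj zero zero e = refl
  cons-inj new inj zero (suc k) e = ⊥-elim (new (k , sym e))
  cons-inj new inj (suc j) zero e = ⊥-elim (new (j , e))
  cons-inj new inj (suc j) (suc k) e = cong suc (inj j k e)

module Coding {I : Set} (u v w : I → Bool) {n : ℕ} (cs : Fin n → I) (inj : ∀ j k → cs j ≡ cs k → j ≡ k)
  (cover : ∀ i → T (nonconst (u i) (v i) (w i)) → ∃ λ k → cs k ≡ i) where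

  Inside : (I → Bool) → Set
  Inside f = ∀ i → T (bx (u i) (v i) (w i) (f i))

  code : (I → Bool) → Pt n
  code f c = f (cs c)

  -- Directions that are not coded are constant on the whole box, which reduces statements over `I`
  -- to finitely many bits.
  on-code : (p : I → Bool) → (∀ i → T (not (nonconst (u i) (v i) (w i))) → T (p i)) → (∀ c → T (p (cs c))) → ∀ i → T (p i)
  on-code p const coded i with decide (nonconst (u i) (v i) (w i))
  ... | inj₂ h = const i h
  ... | inj₁ h with cover i h
  ...   | c , refl = coded c

  decode-≈ : ∀ f g → Inside f → Inside g → code f ≈ code g → ∀ i → T (f i == g i)
  decode-≈ f g F G h = on-code (λ i → f i == g i) (λ i k → taut 5
    (λ u v w f g → not (nonconst u v w) ∷ bx u v w f ∷ bx u v w g ∷ [] ⊢ f == g)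
    (u i) (v i) (w i) (f i) (g i) k (F i) (G i)) h

  decode-btw : ∀ f g h → Inside f → Inside g → btw (code f) (code g) (code h) → Between f g h
  decode-btw f g h F G b = on-code (λ i → bt (f i) (g i) (h i)) (λ i k → taut 6
    (λ u v w f g h → not (nonconst u v w) ∷ bx u v w f ∷ bx u v w g ∷ [] ⊢ bt f g h)
    (u i) (v i) (w i) (f i) (g i) (h i) k (F i) (G i)) b

  inside-between : ∀ f g h → Inside f → Inside h → Between f g h → Inside g
  inside-between f g h F H b i = taut 6
    (λ u v w f g h → bx u v w f ∷ bx u v w h ∷ bt f g h ∷ [] ⊢ bx u v w g)
    (u i) (v i) (w i) (f i) (g i) (h i) (F i) (H i) (b i)

  flipped : ∀ f g t → T (f (cs t) ⊕ g (cs t)) → (∀ i → T (f i ⊕ g i) → i ≡ cs t) → code g ≈ flip t (code f)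
  flipped f g t ft only c with t Fin.≟ c
  ... | yes refl = taut 2 (λ f g → f ⊕ g ∷ [] ⊢ g == (f ⊕ true)) (f (cs t)) (g (cs t)) ft
  ... | no t≢c = reductio _ λ h → t≢c (inj t c (sym (only (cs c)
    (taut 2 (λ f g → not (g == (f ⊕ false)) ∷ [] ⊢ f ⊕ g) (f (cs c)) (g (cs c)) h))))

  flipped-only : ∀ f g t → Inside f → Inside g → code g ≈ flip t (code f) → HammingDist f g 1
  flipped-only f g t F G h = hamming-flip (cs t)
    (taut 3 (λ f g δ → δ ∷ g == (f ⊕ δ) ∷ [] ⊢ f ⊕ g) (f (cs t)) (g (cs t)) (δ t t) (δ-refl t) (h t))
    λ i p → only i p (cover i (taut 5 (λ u v w f g → bx u v w f ∷ bx u v w g ∷ f ⊕ g ∷ [] ⊢ nonconst u v w)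
      (u i) (v i) (w i) (f i) (g i) (F i) (G i) p))
    where
    only : ∀ i → T (f i ⊕ g i) → (∃ λ c → cs c ≡ i) → i ≡ cs t
    only i p (c , refl) = cong cs (sym (δ-≡ {s = t} {t = c}
      (taut 3 (λ f g δ → f ⊕ g ∷ g == (f ⊕ δ) ∷ [] ⊢ δ) (f (cs c)) (g (cs c)) (δ t c) p (h c))))

  module Points {K : Graph} {ψ : V K → I → Bool} (emb : Embedding K ψ) where

    open Embedding emb

    Point : Pt n → Set
    Point b = ∃ λ k → Inside (ψ k) × code (ψ k) ≈ b

    Point-resp : ∀ {x y} → x ≈ y → Point x → Point y
    Point-resp {x} {y} x≈y (k , F , h) = k , F , λ c →
      taut 3 (λ k x y → k == x ∷ x == y ∷ [] ⊢ k == y) (ψ k (cs c)) (x c) (y c) (h c) (x≈y c)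

    Point-isometric : Isometric Point
    Point-isometric x y (k , F , hx) (l , G , hy) c x≠y K with distance k l
    ... | zero , stay , _ = taut 3 (λ k x y → k == x ∷ k == y ∷ x ⊕ y ∷ [] ⊢ false) (ψ k (cs c)) (x c) (y c) (hx c) (hy c) x≠y
    ... | suc m , along {y = k′} e path , min with edge-direction e
    ...   | i , kk′ , only = found (cover i (taut 5 (λ u v w f g → bx u v w f ∷ bx u v w g ∷ f ⊕ g ∷ [] ⊢ nonconst u v w)
              (u i) (v i) (w i) (ψ k i) (ψ k′ i) (F i) (F′ i) kk′))
      where
      bet : Between (ψ k) (ψ k′) (ψ l)
      bet = interval⇒between (1 , m , dist-edge e , dist-tail e path min , along e path , min)
      F′ : Inside (ψ k′)
      F′ = inside-between (ψ k) (ψ k′) (ψ l) F G bet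
      found : (∃ λ t → cs t ≡ i) → ⊥
      found (t , refl) = K (t ,
        taut 5 (λ k k′ l x y → k ⊕ k′ ∷ bt k k′ l ∷ k == x ∷ l == y ∷ [] ⊢ x ⊕ y)
          (ψ k (cs t)) (ψ k′ (cs t)) (ψ l (cs t)) (x t) (y t) kk′ (bet (cs t)) (hx t) (hy t) ,
        k′ , F′ , λ c → taut 4 (λ k k′ x δ → k == x ∷ k′ == (k ⊕ δ) ∷ [] ⊢ k′ == (x ⊕ δ))
          (ψ k (cs c)) (ψ k′ (cs c)) (x c) (δ t c) (hx c) (flipped (ψ k) (ψ k′) t kk′ only c))

  module Retraction {G : Graph} {S : Subset (V G)} {φ : V G → I → Bool} (emb : Embedding G φ) (r : IsRetract G S) where

    open Embedding emb using (from; ext)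

    private
      H = Induced G S
      f = proj₁ r

    embH : Embedding H (λ x → φ (proj₁ x))
    embH = retract-embedding emb r

    module PG = Points emb
    module PH = Points embH

    Points⊆ : ∀ x → PH.Point x → PG.Point x
    Points⊆ x (k , F , h) = proj₁ k , F , h

    -- Both vertices of the edge at `s` are retracted. They land on intervals lying on different
    -- sides of `t`, at distance at most 1, and so form an edge in direction `t` again. The last
    -- clause holds because distances to `b` are kept.
    points-retractable : Retractable PG.Point PH.Point
    points-retractable t β a b q s ((a₁ , Fa , ha) , (a₂ , Fa′ , ha′) , ea) ((b₁ , Fb , hb) , (b₂ , Fb′ , hb′) , eb)
      (q₁ , Fq , hq) aqb ((s₁ , Fs , hs) , (s₂ , Fs′ , hs′) , es) qsb K =
      K (code ψs , ((f s₁ , Ff , λ c → ==-refl (ψs (cs c))) , (f s₂ , Ff′ , adjacent) , sβ) , qfb , back)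
      where
      ψs ψs′ : I → Bool
      ψs = φ (proj₁ (f s₁))
      ψs′ = φ (proj₁ (f s₂))

      between-a : Between (φ (proj₁ a₁)) (φ s₁) (φ (proj₁ b₁))
      between-a = decode-btw (φ (proj₁ a₁)) (φ s₁) (φ (proj₁ b₁)) Fa Fs λ c → taut 8
        (λ a b q s a₁ b₁ q₁ s₁ → a₁ == a ∷ b₁ == b ∷ s₁ == s ∷ bt a q b ∷ bt q s b ∷ [] ⊢ bt a₁ s₁ b₁)
        (a c) (b c) (q c) (s c) (code (φ (proj₁ a₁)) c) (code (φ (proj₁ b₁)) c) (code (φ (proj₁ q₁)) c) (code (φ s₁) c)
        (ha c) (hb c) (hs c) (aqb c) (qsb c)

      between-a′ : Between (φ (proj₁ a₂)) (φ s₂) (φ (proj₁ b₂))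
      between-a′ = decode-btw (φ (proj₁ a₂)) (φ s₂) (φ (proj₁ b₂)) Fa′ Fs′ λ c → taut 8
        (λ a b q s a₂ b₂ s₂ δ → a₂ == (a ⊕ δ) ∷ b₂ == (b ⊕ δ) ∷ s₂ == (s ⊕ δ) ∷
          bt a q b ∷ bt q s b ∷ [] ⊢ bt a₂ s₂ b₂)
        (a c) (b c) (q c) (s c) (code (φ (proj₁ a₂)) c) (code (φ (proj₁ b₂)) c) (code (φ s₂) c) (δ t c)
        (ha′ c) (hb′ c) (hs′ c) (aqb c) (qsb c)

      between-q : Between (φ (proj₁ q₁)) (φ s₁) (φ (proj₁ b₁))
      between-q = decode-btw (φ (proj₁ q₁)) (φ s₁) (φ (proj₁ b₁)) Fq Fs λ c → taut 6
        (λ q s b q₁ s₁ b₁ → q₁ == q ∷ s₁ == s ∷ b₁ == b ∷ bt q s b ∷ [] ⊢ bt q₁ s₁ b₁)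
        (q c) (s c) (b c) (code (φ (proj₁ q₁)) c) (code (φ s₁) c) (code (φ (proj₁ b₁)) c)
        (hq c) (hs c) (hb c) (qsb c)

      fs-a : Between (φ (proj₁ a₁)) ψs (φ (proj₁ b₁))
      fs-a = proj₁ (retraction-between emb r a₁ b₁ s₁ between-a)

      fs-a′ : Between (φ (proj₁ a₂)) ψs′ (φ (proj₁ b₂))
      fs-a′ = proj₁ (retraction-between emb r a₂ b₂ s₂ between-a′)

      fs-q : Between (φ (proj₁ q₁)) ψs (φ (proj₁ b₁))
      fs-q = proj₁ (retraction-between emb r q₁ b₁ s₁ between-q)

      Ff : Inside ψs
      Ff = inside-between (φ (proj₁ a₁)) ψs (φ (proj₁ b₁)) Fa Fb fs-a

      Ff′ : Inside ψs′
      Ff′ = inside-between (φ (proj₁ a₂)) ψs′ (φ (proj₁ b₂)) Fa′ Fb′ fs-a′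

      sβ : T (ψs (cs t) == β)
      sβ = taut 6 (λ a b a₁ b₁ s β → a == β ∷ b == β ∷ a₁ == a ∷ b₁ == b ∷ bt a₁ s b₁ ∷ [] ⊢ s == β)
        (a t) (b t) (φ (proj₁ a₁) (cs t)) (φ (proj₁ b₁) (cs t)) (ψs (cs t)) β ea eb (ha t) (hb t) (fs-a (cs t))

      s′β : T (ψs′ (cs t) ⊕ β)
      s′β = taut 7 (λ a b a₁ b₁ s β δ → δ ∷ a == β ∷ b == β ∷ a₁ == (a ⊕ δ) ∷ b₁ == (b ⊕ δ) ∷ bt a₁ s b₁ ∷ [] ⊢ s ⊕ β)
        (a t) (b t) (φ (proj₁ a₂) (cs t)) (φ (proj₁ b₂) (cs t)) (ψs′ (cs t)) β (δ t t) (δ-refl t) ea eb (ha′ t) (hb′ t) (fs-a′ (cs t))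

      moved : T (ψs (cs t) ⊕ ψs′ (cs t))
      moved = taut 3 (λ s s′ β → s == β ∷ s′ ⊕ β ∷ [] ⊢ s ⊕ s′) (ψs (cs t)) (ψs′ (cs t)) β sβ s′β

      adjacent : code ψs′ ≈ flip t (code ψs)
      adjacent with retraction-≤ emb r (from (flipped-only (φ s₁) (φ s₂) t Fs Fs′ λ c →
        taut 4 (λ s δ x y → x == s ∷ y == (s ⊕ δ) ∷ [] ⊢ y == (x ⊕ δ)) (s c) (δ t c) (code (φ s₁) c) (code (φ s₂) c) (hs c) (hs′ c)))
      ... | zero , p , _ = ⊥-elim (⊕⇒≢ moved (cong (λ x → φ (proj₁ x) (cs t)) (dist-0 p)))
      ... | suc zero , p , _ with hamming-1 (Embedding.to embH p)
      ...   | j , _ , only with only (cs t) moved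
      ...     | refl = flipped ψs ψs′ t moved only
      adjacent | suc (suc m) , p , s≤s ()

      qfb : btw q (code ψs) b
      qfb c = taut 5 (λ q b q₁ b₁ s → q₁ == q ∷ b₁ == b ∷ bt q₁ s b₁ ∷ [] ⊢ bt q s b)
        (q c) (b c) (φ (proj₁ q₁) (cs c)) (φ (proj₁ b₁) (cs c)) (ψs (cs c)) (hq c) (hb c) (fs-q (cs c))

      back : code ψs ≈ b → s ≈ b
      back h c with Embedding.ext embH {f s₁} {b₁} (decode-≈ ψs (φ (proj₁ b₁)) Ff Fb λ c →
        taut 3 (λ s b b₁ → s == b ∷ b₁ == b ∷ [] ⊢ s == b₁) (ψs (cs c)) (b c) (φ (proj₁ b₁) (cs c)) (h c) (hb c))
      ... | fs≡b with Embedding.distance emb s₁ (proj₁ b₁)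
      ...   | m , p with dist-unique (proj₂ (retraction-between emb r q₁ b₁ s₁ between-q) m p)
                          (subst (λ x → Dist H x b₁ 0) (sym fs≡b) (dist-refl b₁))
      ...     | refl with dist-0 p
      ...       | refl = taut 3 (λ s b k → k == s ∷ k == b ∷ [] ⊢ s == b) (s c) (b c) (φ (proj₁ b₁) (cs c)) (hs c) (hb c)

-- Translating the hypothesis and the conclusion

-- The set is split by its first bit. Double negation is due to the case without bits, where it is
-- not known whether there is a member.
finite-by-code : ∀ {X : Set} n (bits : X → Pt n) (A : Subset X) →
  (∀ x y → A x → A y → bits x ≈ bits y → x ≡ y) → ¬ ¬ Finite A
finite-by-code zero bits A determined K = excluded-middle (∃ A) λ
  { (inj₁ (x , Ax)) → K (x ∷ [] , λ y Ay → here (determined y x Ay Ax λ ()))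
  ; (inj₂ empty) → K ([] , λ y Ay → ⊥-elim (empty (y , Ay))) }
finite-by-code (suc n) bits A determined K =
  finite-by-code n tail (λ x → A x × T (bits x zero)) (λ x y (Ax , px) (Ay , py) h → determined x y Ax Ay λ
    { zero → taut 2 (λ a b → a ∷ b ∷ [] ⊢ a == b) (bits x zero) (bits y zero) px py ; (suc c) → h c }) λ (xs , cov) →
  finite-by-code n tail (λ x → A x × T (not (bits x zero))) (λ x y (Ax , px) (Ay , py) h → determined x y Ax Ay λ
    { zero → taut 2 (λ a b → not a ∷ not b ∷ [] ⊢ a == b) (bits x zero) (bits y zero) px py ; (suc c) → h c }) λ (ys , cov′) →
  K (xs ++ ys , λ x Ax → [ (λ p → ∈-++⁺ˡ (cov x (Ax , p))) , (λ p → ∈-++⁺ʳ xs (cov′ x (Ax , p))) ]′ (decide (bits x zero)))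
  where
  tail = λ x c → bits x (suc c)

-- The convex hull generated from below. Unlike `co`, which lives in `Set₁`, it is a `Subset`, so
-- `convex-reaches-vertex` applies to it.
data Closure (K : Graph) (A : Subset (V K)) : Subset (V K) where
  base : ∀ {x} → A x → Closure K A x
  grow : ∀ {x y z} → Closure K A x → Closure K A y → Interval K x y z → Closure K A z

closure⊆co : ∀ {K A z} → Closure K A z → co K A z
closure⊆co (base p) B convex sub = sub _ p
closure⊆co (grow p q i) B convex sub = convex _ _ _ (closure⊆co p B convex sub) (closure⊆co q B convex sub) i

module Hypothesis {G : Graph} {I : Set} {φ : V G → I → Bool} (emb : Embedding G φ)
  (peano : ∀ (A : Subset (V G)) → PropValued A → Convex G A → Finite A → PreHullAtMost (Induced G A) 1)
  (u v w : V G) {n : ℕ} (cs : Fin n → I) (inj : ∀ j k → cs j ≡ cs k → j ≡ k)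
  (cover : ∀ i → T (nonconst (φ u i) (φ v i) (φ w i)) → ∃ λ k → cs k ≡ i) where

  open Coding (φ u) (φ v) (φ w) cs inj cover
  open Points emb using (Point; Point-isometric)

  module FaceGraph (m o : Pt n) where

    FacePoint : Pt n → Set
    FacePoint = Face Point m o

    iso : Isometric FacePoint
    iso = Face-isometric Point-isometric m o

    inside-at : V G → I → Bool
    inside-at g i = bx (φ u i) (φ v i) (φ w i) (φ g i)

    face-at : V G → Fin n → Bool
    face-at g c = m c ⇒ φ g (cs c) == o c

    directions : V G → List I
    directions g = proj₁ (Embedding.to emb (proj₂ (Embedding.distance emb u g)))

    -- Boolean membership makes `A` proposition-valued. Finitely many directions suffice for the
    -- test, since elsewhere `g` agrees with `u` and the box condition is automatic.
    A : Subset (V G)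
    A g = T (all (inside-at g) (directions g) ∧ all (face-at g) (allFin n))

    inside : ∀ {g} → A g → Inside (φ g)
    inside {g} p i = [ (λ h → All.lookup (all⁺ (inside-at g) (directions g) (∧-left _ (all (face-at g) (allFin n)) p))
        (hamming-∈ (Embedding.to emb (proj₂ (Embedding.distance emb u g))) i h))
      , taut 4 (λ u v w g → not (u ⊕ g) ∷ [] ⊢ bx u v w g) (φ u i) (φ v i) (φ w i) (φ g i) ]′ (decide (φ u i ⊕ φ g i))

    on-face : ∀ {g} → A g → ∀ c → T (face-at g c)
    on-face {g} p c = All.lookup (all⁺ (face-at g) (allFin n) (∧-right (all (inside-at g) (directions g)) _ p)) (∈-allFin c)

    member : ∀ g → Inside (φ g) → (∀ c → T (face-at g c)) → A g
    member g F h = taut 2 (λ a b → a ∷ b ∷ [] ⊢ a ∧ b) _ _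
      (all⁻ (inside-at g) (All.tabulate {xs = directions g} (λ {i} _ → F i)))
      (all⁻ (face-at g) (All.tabulate {xs = allFin n} (λ {c} _ → h c)))

    A-prop : PropValued A
    A-prop g = Bool.T-irrelevant

    A-convex : Convex G A
    A-convex x y z Ax Ay i = member z (inside-between (φ x) (φ z) (φ y) (inside Ax) (inside Ay) bet) λ c →
      taut 5 (λ m o x y z → (m ⇒ x == o) ∷ (m ⇒ y == o) ∷ bt x z y ∷ [] ⊢ m ⇒ z == o)
        (m c) (o c) (φ x (cs c)) (φ y (cs c)) (φ z (cs c)) (on-face Ax c) (on-face Ay c) (bet (cs c))
      where
      bet : Between (φ x) (φ z) (φ y)
      bet = Embedding.interval⇒between emb i

    A-finite : ¬ ¬ Finite A
    A-finite = finite-by-code n (λ g → code (φ g)) A λ x y Ax Ay h →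
      Embedding.ext emb (decode-≈ (φ x) (φ y) (inside Ax) (inside Ay) h)

    K : Graph
    K = Induced G A

    ψ : V K → I → Bool
    ψ k = φ (proj₁ k)

    embK : Embedding K ψ
    embK = convex-embedding emb A-prop A-convex

    open Embedding embK using (interval⇒between; between⇒interval; ext)

    bits : V K → Pt n
    bits k = code (ψ k)

    facePoint : ∀ k → FacePoint (bits k)
    facePoint (g , Ag) = (g , inside Ag , λ c → ==-refl (φ g (cs c))) , on-face Ag

    vertex : ∀ {b} → FacePoint b → ∃ λ k → bits k ≈ b
    vertex {b} ((g , F , h) , face) = (g , member g F λ c →
      taut 4 (λ m o g b → (m ⇒ b == o) ∷ g == b ∷ [] ⊢ m ⇒ g == o) (m c) (o c) (φ g (cs c)) (b c) (face c) (h c)) , h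

    code-interval : ∀ x y z → btw (bits x) (bits z) (bits y) → Interval K x y z
    code-interval x y z b = between⇒interval (decode-btw (ψ x) (ψ z) (ψ y) (inside (proj₂ x)) (inside (proj₂ z)) b)

    convex-reaches-vertex : (D : Subset (V K)) → Convex K D → ∀ k → D k → ∀ q →
      (∀ c → ¬ (∀ k → D k → T (bits k c ⊕ bits q c))) → ¬ ¬ D q
    convex-reaches-vertex D convex k Dk q hull ¬Dq =
      convex-reaches iso D̂ (λ x → proj₁) convex̂ (bits k) (facePoint k , k , Dk , (λ c → ==-refl (bits k c)))
        (bits q) (facePoint q) (λ c sep → hull c λ l Dl → sep (bits l) (facePoint l , l , Dl , λ c → ==-refl (bits l c)))
        λ (r , (_ , l , Dl , l≈r) , r≈q) → ¬Dq (subst D (ext (decode-≈ (ψ l) (ψ q) (inside (proj₂ l)) (inside (proj₂ q)) λ c →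
          taut 3 (λ l r q → l == r ∷ r == q ∷ [] ⊢ l == q) (bits l c) (r c) (bits q c) (l≈r c) (r≈q c))) Dl)
      where
      D̂ : Pt n → Set
      D̂ b = FacePoint b × ∃ λ l → D l × bits l ≈ b
      convex̂ : ∀ x y z → D̂ x → D̂ y → FacePoint z → btw x z y → ¬ ¬ D̂ z
      convex̂ x y z (_ , k , Dk , hk) (_ , l , Dl , hl) Fz xzy missing with vertex Fz
      ... | r , hr = missing (Fz , r , convex k l r Dk Dl (code-interval k l r λ c →
        taut 6 (λ x y z k l r → k == x ∷ l == y ∷ r == z ∷ bt x z y ∷ [] ⊢ bt k r l)
          (x c) (y c) (z c) (bits k c) (bits l c) (bits r c) (hk c) (hl c) (hr c) (xzy c)) , hr)

    preHull : PreHull FacePoint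
    preHull t β p q Fp Fq hull-p hull-q result = A-finite λ fin → use (peano A A-prop A-convex fin)
      where
      kp kq : V K
      kp = proj₁ (vertex Fp)
      kq = proj₁ (vertex Fq)
      p≈ : bits kp ≈ p
      p≈ = proj₂ (vertex Fp)
      q≈ : bits kq ≈ q
      q≈ = proj₂ (vertex Fq)

      side : ∀ {x} → Hull (Ends FacePoint t β) x → T (x t == β)
      side {x} hull = reductio _ λ h → hull t λ s (_ , _ , e) →
        taut 3 (λ x s β → not (x == β) ∷ s == β ∷ [] ⊢ s ⊕ x) (x t) (s t) β h e

      C : Subset (V K)
      C k = T (bits k t ⊕ β)

      convexC : Convex K C
      convexC x y z Cx Cy i = taut 4 (λ x y z β → x ⊕ β ∷ y ⊕ β ∷ bt x z y ∷ [] ⊢ z ⊕ β)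
        (bits x t) (bits y t) (bits z t) β Cx Cy (interval⇒between i (cs t))

      ¬Cp : ¬ C kp
      ¬Cp = taut 3 (λ k p β → k == p ∷ p == β ∷ k ⊕ β ∷ [] ⊢ false) (bits kp t) (p t) β (p≈ t) (side hull-p)

      ¬Cq : ¬ C kq
      ¬Cq = taut 3 (λ k p β → k == p ∷ p == β ∷ k ⊕ β ∷ [] ⊢ false) (bits kq t) (q t) β (q≈ t) (side hull-q)

      opposite : ∀ s → FacePoint (flip t s) → T (s t == β) → ∃ λ k → bits k ≈ flip t s × C k
      opposite s Fs e with vertex Fs
      ... | k , h = k , h , taut 4 (λ k s δ β → δ ∷ k == (s ⊕ δ) ∷ s == β ∷ [] ⊢ k ⊕ β)
        (bits k t) (s t) (δ t t) β (δ-refl t) (h t) e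

      -- A vertex of `D` on the side of `p` forces every end into `D`, since an end lies between
      -- that vertex and its own neighbour across `t`. Then `p`, being in the hull of the ends, is
      -- in `D` as well.
      maximalC : ∀ (D : Subset (V K)) → Convex K D → C ⊆ D → ¬ D kp → D ⊆ C
      maximalC D convexD C⊆D ¬Dp k Dk = reductio _ λ h → convex-reaches-vertex D convexD k Dk kp
        (λ c sep → hull-p c λ s (Fs , Fs′ , e) → step h c sep s Fs Fs′ e) ¬Dp
        where
        step : T (not (bits k t ⊕ β)) → ∀ c → (∀ l → D l → T (bits l c ⊕ bits kp c)) →
          ∀ s → FacePoint s → FacePoint (flip t s) → T (s t == β) → T (s c ⊕ p c)
        step h c sep s Fs Fs′ e with vertex Fs | opposite s Fs′ e
        ... | l , l≈ | l′ , l′≈ , Cl′ = taut 4 (λ s p l k → l == s ∷ k == p ∷ l ⊕ k ∷ [] ⊢ s ⊕ p)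
          (s c) (p c) (bits l c) (bits kp c) (l≈ c) (p≈ c)
          (sep l (convexD k l′ l Dk (C⊆D l′ Cl′) (code-interval k l′ l λ c →
            taut 5 (λ s k l l′ δ → l == s ∷ l′ == (s ⊕ δ) ∷ (δ ⇒ k == s) ∷ [] ⊢ bt k l l′)
              (s c) (bits k c) (bits l c) (bits l′ c) (δ t c) (l≈ c) (l′≈ c)
              (at (λ c → bits k c == s c) t
                (taut 3 (λ k s β → not (k ⊕ β) ∷ s == β ∷ [] ⊢ k == s) (bits k t) (s t) β h e) c))))

      copoint : Copoint K C kp
      copoint = convexC , ¬Cp , maximalC

      cone : Subset (V K)
      cone = _∪｛_｝ K C kp

      -- Every end lies between `kp` and its neighbour in `C`, so the closure of the cone contains
      -- all ends and reaches their hull.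
      generated : ¬ ¬ Closure K cone kq
      generated = convex-reaches-vertex (Closure K cone) (λ x y z → grow) kp (base (inj₂ refl)) kq
        λ c sep → hull-q c λ s (Fs , Fs′ , e) → step c sep s Fs′ e
        where
        step : ∀ c → (∀ l → Closure K cone l → T (bits l c ⊕ bits kq c)) →
          ∀ s → FacePoint (flip t s) → T (s t == β) → T (s c ⊕ q c)
        step c sep s Fs′ e with opposite s Fs′ e
        ... | l , l≈ , Cl = taut 7 (λ p q s kp kq l δ → kp == p ∷ kq == q ∷ l == (s ⊕ δ) ∷ (δ ⇒ p == s) ∷
              kp ⊕ kq ∷ l ⊕ kq ∷ [] ⊢ s ⊕ q)
          (p c) (q c) (s c) (bits kp c) (bits kq c) (bits l c) (δ t c) (p≈ c) (q≈ c) (l≈ c)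
          (at (λ c → p c == s c) t (taut 3 (λ p s β → p == β ∷ s == β ∷ [] ⊢ p == s) (p t) (s t) β (side hull-p) e) c)
          (sep kp (base (inj₂ refl))) (sep l (base (inj₁ Cl)))

      -- If `p` and `q` coincide, any end will do, and `hull-p` provides one.
      same : bits kp ≈ bits kq → ⊥
      same h = hull-p t λ s Es → ⊥-elim (result (s , Es , λ c →
        taut 5 (λ p q s kp kq → kp == p ∷ kq == q ∷ kp == kq ∷ [] ⊢ bt p q s)
          (p c) (q c) (s c) (bits kp c) (bits kq c) (p≈ c) (q≈ c) (h c)))

      towards : ∀ c → C c → Between (ψ kp) (ψ kq) (ψ c) → ⊥
      towards c Cc bet = crossing iso t q (bits c) Fq (facePoint c)
        (taut 3 (λ q c β → q == β ∷ c ⊕ β ∷ [] ⊢ q ⊕ c) (q t) (bits c t) β (side hull-q) Cc)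
        λ (s , Fs , Fs′ , e , qsc) → result (s ,
          (Fs , Fs′ , taut 3 (λ s q β → s == q ∷ q == β ∷ [] ⊢ s == β) (s t) (q t) β e (side hull-q)) ,
          λ i → taut 6 (λ p q s kp kq c → kp == p ∷ kq == q ∷ bt kp kq c ∷ bt q s c ∷ [] ⊢ bt p q s)
            (p i) (q i) (s i) (bits kp i) (bits kq i) (bits c i) (p≈ i) (q≈ i) (bet (cs i)) (qsc i))

      use : PreHullAtMost K 1 → ⊥
      use (N , N≤1 , ph) = generated λ cl → reached N N≤1 (proj₁ (ph kp C copoint) kq (closure⊆co cl))
        where
        reached : ∀ N → N ≤ 1 → IntervalHullIter K N cone kq → ⊥
        reached zero _ (inj₁ Cq) = ¬Cq Cq
        reached zero _ (inj₂ e) = same λ c → subst (λ k → T (bits k c == bits kq c)) e (==-refl (bits kq c))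
        reached (suc zero) _ (x , y , inj₁ Cx , inj₁ Cy , i) = ¬Cq (convexC x y kq Cx Cy i)
        reached (suc zero) _ (x , y , inj₁ Cx , inj₂ refl , i) = towards x Cx λ j →
          taut 3 (λ x z y → bt x z y ∷ [] ⊢ bt y z x) (ψ x j) (ψ kq j) (ψ kp j) (interval⇒between i j)
        reached (suc zero) _ (x , y , inj₂ refl , inj₁ Cy , i) = towards y Cy (interval⇒between i)
        reached (suc zero) _ (x , y , inj₂ refl , inj₂ refl , i) = same λ c →
          taut 2 (λ p q → bt p q p ∷ [] ⊢ p == q) (bits kp c) (bits kq c) (interval⇒between i (cs c))
        reached (suc (suc N)) (s≤s ()) _

  hereditary : HereditaryPreHull Point
  hereditary = FaceGraph.preHull

-- Pre-hull numbers of the finite convex subgraphs of the retract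

module Retract {G : Graph} {S : Subset (V G)} {I : Set} {φ : V G → I → Bool} (propS : PropValued S)
  (emb : Embedding G φ) (r : IsRetract G S)
  (peano : ∀ (A : Subset (V G)) → PropValued A → Convex G A → Finite A → PreHullAtMost (Induced G A) 1) where

  H : Graph
  H = Induced G S

  ψ : V H → I → Bool
  ψ h = φ (proj₁ h)

  embH : Embedding H ψ
  embH = retract-embedding emb r

  graph-joinHull : ∀ (x y z p : V H) → (∀ i → T (bx (ψ x i) (ψ y i) (ψ z i) (ψ p i))) →
    ¬ ¬ ∃ λ h → Between (ψ y) (ψ h) (ψ z) × Between (ψ x) (ψ p) (ψ h)
  graph-joinHull x y z p box K = enumerate (directions y ++ directions z) λ (n , cs , inj , cover) →
    coded cs inj λ i h → cover i ([ (λ q → ∈-++⁺ˡ (listed y i q)) , (λ q → ∈-++⁺ʳ (directions y) (listed z i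
      (taut 3 (λ x y z → nonconst x y z ∷ not (x ⊕ y) ∷ [] ⊢ x ⊕ z) (ψ x i) (ψ y i) (ψ z i) h q))) ]′
      (decide (ψ x i ⊕ ψ y i)))
    where
    directions : V H → List I
    directions y = proj₁ (Embedding.to embH (proj₂ (Embedding.distance embH x y)))
    listed : ∀ y i → T (ψ x i ⊕ ψ y i) → i ∈ directions y
    listed y = hamming-∈ (Embedding.to embH (proj₂ (Embedding.distance embH x y)))
    coded : ∀ {n} (cs : Fin n → I) → (∀ j k → cs j ≡ cs k → j ≡ k) →
      (∀ i → T (nonconst (ψ x i) (ψ y i) (ψ z i)) → ∃ λ k → cs k ≡ i) → ⊥
    coded cs inj cover = retract-joinHull PG.Point-resp PH.Point-resp Points⊆ PG.Point-isometric PH.Point-isometric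
      (Hypothesis.hereditary emb peano (proj₁ x) (proj₁ y) (proj₁ z) cs inj cover) points-retractable
      (code (ψ x)) (code (ψ y)) (code (ψ z)) (code (ψ p))
      (point x λ i → taut 3 (λ x y z → [] ⊢ bx x y z x) (ψ x i) (ψ y i) (ψ z i))
      (point y λ i → taut 3 (λ x y z → [] ⊢ bx x y z y) (ψ x i) (ψ y i) (ψ z i))
      (point z λ i → taut 3 (λ x y z → [] ⊢ bx x y z z) (ψ x i) (ψ y i) (ψ z i))
      (point p box) (λ c → box (cs c))
      λ (b , (h , F , h≈) , yhz , xph) → K (h ,
        decode-btw (ψ y) (ψ h) (ψ z) (λ i → taut 3 (λ x y z → [] ⊢ bx x y z y) (ψ x i) (ψ y i) (ψ z i)) F
          (λ c → taut 4 (λ y b z h → h == b ∷ bt y b z ∷ [] ⊢ bt y h z)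
            (ψ y (cs c)) (b c) (ψ z (cs c)) (ψ h (cs c)) (h≈ c) (yhz c)) ,
        decode-btw (ψ x) (ψ p) (ψ h) (λ i → taut 3 (λ x y z → [] ⊢ bx x y z x) (ψ x i) (ψ y i) (ψ z i)) box
          (λ c → taut 4 (λ x p b h → h == b ∷ bt x p b ∷ [] ⊢ bt x p h)
            (ψ x (cs c)) (ψ p (cs c)) (b c) (ψ h (cs c)) (h≈ c) (xph c)))
      where
      open Coding (ψ x) (ψ y) (ψ z) cs inj cover
      open Retraction emb r
      point : ∀ h → Inside (ψ h) → PH.Point (code (ψ h))
      point h F = h , F , λ c → ==-refl (ψ h (cs c))

  module _ (A : Subset (V H)) (propA : PropValued A) (convexA : Convex H A) (finA : Finite A) where

    K : Graph
    K = Induced H A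

    χ : V K → I → Bool
    χ k = ψ (proj₁ k)

    open Embedding (convex-embedding embH propA convexA) using (interval⇒between; between⇒interval)

    -- A witness lies on I(y,z), hence in the finite convex set, and can be recognised by
    -- `between?`; so a search removes the double negation.
    join : ∀ (x y z p : V K) → (∀ i → T (bx (χ x i) (χ y i) (χ z i) (χ p i))) →
      ∃ λ k → Between (χ y) (χ k) (χ z) × Between (χ x) (χ p) (χ k)
    join x y z p box = choose (find (decidable-stable (any? good? (proj₁ finA)) λ none →
        graph-joinHull (proj₁ x) (proj₁ y) (proj₁ z) (proj₁ p) box λ (h , yhz , xph) →
          none (lose (proj₂ finA h (in-A h yhz)) (yhz , xph))))
      where
      Good : V H → Set
      Good h = Between (χ y) (ψ h) (χ z) × Between (χ x) (χ p) (ψ h)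
      good? : ∀ h → Dec (Good h)
      good? h = Embedding.between? embH (proj₁ y) h (proj₁ z) ×-dec Embedding.between? embH (proj₁ x) (proj₁ p) h
      in-A : ∀ h → Between (χ y) (ψ h) (χ z) → A h
      in-A h b = convexA (proj₁ y) (proj₁ z) h (proj₂ y) (proj₂ z) (Embedding.between⇒interval embH b)
      choose : (∃ λ h → h ∈ proj₁ finA × Good h) → ∃ λ k → Between (χ y) (χ k) (χ z) × Between (χ x) (χ p) (χ k)
      choose (h , _ , yhz , xph) = (h , in-A h yhz) , yhz , xph

    module _ (x : V K) (C : Subset (V K)) (convexC : Convex K C) where

      cone hull : Subset (V K)
      cone = _∪｛_｝ K C x
      hull = IntervalHull K cone

      -- The join of `x` and `C`; the first summand is there for an empty `C`.
      Seen : Subset (V K)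
      Seen z = z ≡ x ⊎ ∃ λ c → C c × Between (χ x) (χ z) (χ c)

      seen⇒hull : ∀ {z} → Seen z → hull z
      seen⇒hull (inj₁ refl) = x , x , inj₂ refl , inj₂ refl ,
        between⇒interval λ i → taut 1 (λ x → [] ⊢ bt x x x) (χ x i)
      seen⇒hull (inj₂ (c , Cc , b)) = x , c , inj₂ refl , inj₁ Cc , between⇒interval b

      hull⇒seen : ∀ {z} → hull z → Seen z
      hull⇒seen {z} (a , b , inj₁ Ca , inj₁ Cb , i) = inj₂ (z , convexC a b z Ca Cb i , λ j →
        taut 2 (λ x z → [] ⊢ bt x z z) (χ x j) (χ z j))
      hull⇒seen {z} (a , b , inj₁ Ca , inj₂ refl , i) = inj₂ (a , Ca , λ j →
        taut 3 (λ a z x → bt a z x ∷ [] ⊢ bt x z a) (χ a j) (χ z j) (χ x j) (interval⇒between i j))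
      hull⇒seen (a , b , inj₂ refl , inj₁ Cb , i) = inj₂ (b , Cb , interval⇒between i)
      hull⇒seen {z} (a , b , inj₂ refl , inj₂ refl , i) = inj₁ (Embedding.ext (convex-embedding embH propA convexA) λ j →
        taut 2 (λ z x → bt x z x ∷ [] ⊢ z == x) (χ z j) (χ x j) (interval⇒between i j))

      seen-from-x : ∀ {q z} → Seen q → Between (χ x) (χ z) (χ q) → Seen z
      seen-from-x {q} {z} (inj₁ refl) b = inj₁ (Embedding.ext (convex-embedding embH propA convexA) λ j →
        taut 2 (λ z x → bt x z x ∷ [] ⊢ z == x) (χ z j) (χ x j) (b j))
      seen-from-x {q} {z} (inj₂ (c , Cc , bq)) b = inj₂ (c , Cc , λ j →
        taut 4 (λ x z q c → bt x q c ∷ bt x z q ∷ [] ⊢ bt x z c) (χ x j) (χ z j) (χ q j) (χ c j) (bq j) (b j))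

      -- In the main case `z` is in the box of `x`, `c`, `c′`, so `x` sees it on the way to a point
      -- of I(c,c′), which belongs to `C`.
      seen-convex : ∀ {p q z} → Seen p → Seen q → Between (χ p) (χ z) (χ q) → Seen z
      seen-convex {p} {q} {z} (inj₁ refl) sq b = seen-from-x sq b
      seen-convex {p} {q} {z} sp@(inj₂ _) (inj₁ refl) b = seen-from-x {p} sp λ j →
        taut 3 (λ p z x → bt p z x ∷ [] ⊢ bt x z p) (χ p j) (χ z j) (χ x j) (b j)
      seen-convex {p} {q} {z} (inj₂ (c , Cc , bp)) (inj₂ (c′ , Cc′ , bq)) b = seen-beyond (join x c c′ z λ j → taut 6
          (λ x c c′ p q z → bt x p c ∷ bt x q c′ ∷ bt p z q ∷ [] ⊢ bx x c c′ z)
          (χ x j) (χ c j) (χ c′ j) (χ p j) (χ q j) (χ z j) (bp j) (bq j) (b j))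
        where
        seen-beyond : (∃ λ k → Between (χ c) (χ k) (χ c′) × Between (χ x) (χ z) (χ k)) → Seen z
        seen-beyond (k , ckc′ , xzk) = inj₂ (k , convexC c c′ k Cc Cc′ (between⇒interval ckc′) , xzk)

      hull-convex : Convex K hull
      hull-convex p q z hp hq i = seen⇒hull (seen-convex (hull⇒seen hp) (hull⇒seen hq) (interval⇒between i))

      cone⊆hull : cone ⊆ hull
      cone⊆hull z cz = z , z , cz , cz , between⇒interval λ i → taut 1 (λ x → [] ⊢ bt x x x) (χ z i)

    preHullAtMost-1 : PreHullAtMost K 1
    preHullAtMost-1 = 1 , ≤-refl , λ x C (convexC , _) →
      (λ z z∈co → z∈co (hull x C convexC) (hull-convex x C convexC) (cone⊆hull x C convexC)) ,
      λ z (a , b , ca , cb , i) B convexB sub → convexB a b z (sub a ca) (sub b cb) i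

theorem6p4 : (G : Graph) (S : Subset (V G)) → PropValued S →
    PeanoPartialCube G → IsRetract G S → PeanoPartialCube (Induced G S)
theorem6p4 G S propS ((conn , I , φ , iso) , peano) r =
  (Embedding.connected embH , I , ψ , λ x y n → Embedding.to embH , Embedding.from embH) , preHullAtMost-1
  where
  emb : Embedding G φ
  emb = record { connected = conn ; to = proj₁ (iso _ _ _) ; from = proj₂ (iso _ _ _) }
  open Retract propS emb r peano
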